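{- The closed fragment $\mathbf{IL}_0$ of $\mathbf{IL}$, i.e. the set of formulas containing no propositional variables that are theorems of $\mathbf{IL}$, is PSPACE-hard (with respect to polynomial-time many-one reductions).
   Context: $\mathbf{IL}$ is the logic in the language with a unary modality $\Box$ and a binary modality $\rhd$ (formulas built from propositional variables, $\bot$, $\to$, $\Box$, $\rhd$; $\Diamond\varphi$ abbreviates $\neg\Box\neg\varphi$, $\top$ abbreviates $\neg\bot$), with rules Modus Ponens and Necessitation, whose axioms are all propositional tautologies, all instances of $\Box(A\to B)\to(\Box A\to\Box B)$ and $\Box(\Box A\to A)\to\Box A$, and all instances of: (J1) $\Box(A\to B)\to A\rhd B$; (J2) $(A\rhd B)\wedge(B\rhd C)\to A\rhd C$; (J3) $(A\rhd C)\wedge(B\rhd C)\to (A\vee B)\rhd C$; (J4) $A\rhd B\to(\Diamond A\to\Diamond B)$; (J5) $\Diamond A\rhd A$. -}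

module Defs where

open import Data.Bool using (Bool; true; false; not; _∨_)
open import Data.Fin using (Fin)
open import Data.List using (List; []; _∷_; _++_; length; map; replicate; reverse)
open import Data.Maybe using (Maybe; just; nothing)
import Data.Maybe as Maybe
open import Data.Nat using (ℕ; suc; _+_; _*_; _≤_)
open import Data.Product using (Σ-syntax; ∃-syntax; _×_; _,_; proj₁)
open import Data.Unit using (⊤)
open import Data.Empty using (⊥)
open import Data.Vec using (Vec)
import Data.Vec as Vec
open import Function.Bundles using (_↔_; _⇔_; _↣_; Injection)
open import Relation.Binary.PropositionalEquality using (_≡_; _≢_)

infixr 20 _⇒_
infix  25 _▷_
infixr 30 _∧ᶠ_
infixr 28 _∨ᶠ_
infix  40 □_ ◇_ ¬ᶠ_

data Formula : Set where
  var : ℕ → Formula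
  ⊥ᶠ  : Formula
  _⇒_ : Formula → Formula → Formula
  □_  : Formula → Formula
  _▷_ : Formula → Formula → Formula

¬ᶠ_ ◇_ : Formula → Formula
¬ᶠ A = A ⇒ ⊥ᶠ
◇ A = ¬ᶠ (□ (¬ᶠ A))

_∧ᶠ_ _∨ᶠ_ : Formula → Formula → Formula
A ∧ᶠ B = ¬ᶠ (A ⇒ ¬ᶠ B)
A ∨ᶠ B = (¬ᶠ A) ⇒ B

-- Variables and formulas of the form □ A or A ▷ B are propositional atoms;
-- v assigns them truth values (its values on other formulas are ignored).
eval : (Formula → Bool) → Formula → Bool
eval v ⊥ᶠ        = false
eval v (A ⇒ B)   = not (eval v A) ∨ eval v B
eval v A@(var _) = v A
eval v A@(□ _)   = v A
eval v A@(_ ▷ _) = v A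

Tautology : Formula → Set
Tautology A = (v : Formula → Bool) → eval v A ≡ true

infix 4 IL⊢_

data IL⊢_ : Formula → Set where
  taut : ∀ {A} → Tautology A → IL⊢ A
  K    : ∀ {A B} → IL⊢ □ (A ⇒ B) ⇒ (□ A ⇒ □ B)
  Löb  : ∀ {A} → IL⊢ □ (□ A ⇒ A) ⇒ □ A
  J1   : ∀ {A B} → IL⊢ □ (A ⇒ B) ⇒ (A ▷ B)
  J2   : ∀ {A B C} → IL⊢ ((A ▷ B) ∧ᶠ (B ▷ C)) ⇒ (A ▷ C)
  J3   : ∀ {A B C} → IL⊢ ((A ▷ C) ∧ᶠ (B ▷ C)) ⇒ ((A ∨ᶠ B) ▷ C)
  J4   : ∀ {A B} → IL⊢ (A ▷ B) ⇒ (◇ A ⇒ ◇ B)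
  J5   : ∀ {A} → IL⊢ (◇ A) ▷ A
  mp   : ∀ {A B} → IL⊢ A ⇒ B → IL⊢ A → IL⊢ B
  nec  : ∀ {A} → IL⊢ A → IL⊢ □ A

Closed : Formula → Set
Closed (var _) = ⊥
Closed ⊥ᶠ      = ⊤
Closed (A ⇒ B) = Closed A × Closed B
Closed (□ A)   = Closed A
Closed (A ▷ B) = Closed A × Closed B

-- Formulas are written as words in Polish notation; the variable with index n
-- is the symbol `x` followed by n copies of `tick`.
data Symbol : Set where
  bot imp box rhd x tick : Symbol

encode : Formula → List Symbol
encode (var n) = x ∷ replicate n tick
encode ⊥ᶠ      = bot ∷ []
encode (A ⇒ B) = imp ∷ encode A ++ encode B
encode (□ A)   = box ∷ encode A
encode (A ▷ B) = rhd ∷ encode A ++ encode B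

Language : Set → Set₁
Language A = List A → Set

IL₀ : Language Symbol
IL₀ w = ∃[ φ ] (encode φ ≡ w × Closed φ × IL⊢ φ)

Finite : Set → Set
Finite A = ∃[ n ] (A ↔ Fin n)

data Move : Set where
  left stay right : Move

-- A two-way infinite tape.  `before` lists the cells to the left of the head,
-- nearest first; `after` those to its right.  All unlisted cells are blank;
-- a cell gets listed when the head first enters it and stays listed.
record Tape (Γ : Set) : Set where
  constructor tape
  field
    before  : List Γ
    scanned : Γ
    after   : List Γ

open Tape public

cells : ∀ {Γ} → Tape Γ → List Γ
cells (tape ls a rs) = reverse ls ++ a ∷ rs

record Machine : Set₁ where
  field
    k       : ℕ          -- the machine has suc k tapes
    Q       : Set
    Q-fin   : Finite Q
    Γ       : Set
    Γ-fin   : Finite Γ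
    blank   : Γ
    start   : Q
    -- The machine halts when δ is undefined.
    δ       : Q → Vec Γ (suc k) → Maybe (Q × Vec (Γ × Move) (suc k))

  Tapes : Set
  Tapes = Vec (Tape Γ) (suc k)

  Config : Set
  Config = Q × Tapes

  moveHead : Move → Tape Γ → Tape Γ
  moveHead stay  t                    = t
  moveHead left  (tape []       a rs) = tape [] blank (a ∷ rs)
  moveHead left  (tape (l ∷ ls) a rs) = tape ls l (a ∷ rs)
  moveHead right (tape ls a [])       = tape (a ∷ ls) blank []
  moveHead right (tape ls a (r ∷ rs)) = tape (a ∷ ls) r rs

  act : Γ × Move → Tape Γ → Tape Γ
  act (b , m) (tape ls _ rs) = moveHead m (tape ls b rs)

  step : Config → Maybe Config
  step (q , ts) =
    Maybe.map (λ (q′ , as) → q′ , Vec.zipWith act as ts)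
              (δ q (Vec.map scanned ts))

  infix 4 _↝[_]_

  data _↝[_]_ : Config → ℕ → Config → Set where
    done : ∀ {c} → c ↝[ 0 ] c
    next : ∀ {c c′ c″ t} → step c ≡ just c′ → c′ ↝[ t ] c″ → c ↝[ suc t ] c″

  Halted : Config → Set
  Halted c = step c ≡ nothing

  emptyTape : Tape Γ
  emptyTape = tape [] blank []

  wordTape : List Γ → Tape Γ
  wordTape []       = emptyTape
  wordTape (a ∷ as) = tape [] a as

  -- The input is on the first tape, the head on its first symbol.
  initial : List Γ → Config
  initial w = start , wordTape w Vec.∷ Vec.replicate k emptyTape

  space : Config → ℕ
  space (_ , ts) = Vec.sum (Vec.map (λ t → length (cells t)) ts)

  -- The last tape holds w surrounded by blanks.
  HasOutput : Config → List Γ → Set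
  HasOutput (_ , ts) w =
    ∃[ i ] ∃[ j ] cells (Vec.last ts) ≡ replicate i blank ++ w ++ replicate j blank

  -- An identification of the alphabet A with a set of nonblank tape symbols.
  Embeds : Set → Set
  Embeds A = Σ[ ι ∈ A ↣ Γ ] (∀ a → Injection.to ι a ≢ blank)

  word : ∀ {A} → Embeds A → List A → List Γ
  word (ι , _) = map (Injection.to ι)

-- Polynomials over ℕ, as lists of coefficients, constant term first.
Polynomial : Set
Polynomial = List ℕ

⟦_⟧ : Polynomial → ℕ → ℕ
⟦ [] ⟧    n = 0
⟦ a ∷ p ⟧ n = a + n * ⟦ p ⟧ n

record PSPACE {A : Set} (L : Language A) : Set₁ where
  field
    machine : Machine
  open Machine machine public
  field
    input    : Embeds A
    accept   : Q → Bool
    bound    : Polynomial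
    decides  : ∀ w → ∃[ t ] ∃[ c ] (initial (word input w) ↝[ t ] c
                                    × Halted c
                                    × (L w ⇔ accept (proj₁ c) ≡ true))
    in-space : ∀ w {t c} → initial (word input w) ↝[ t ] c → space c ≤ ⟦ bound ⟧ (length w)

record PolyTime {A B : Set} (f : List A → List B) : Set₁ where
  field
    machine : Machine
  open Machine machine public
  field
    input    : Embeds A
    output   : Embeds B
    bound    : Polynomial
    computes : ∀ w → ∃[ t ] ∃[ c ] (t ≤ ⟦ bound ⟧ (length w)
                                    × initial (word input w) ↝[ t ] c
                                    × Halted c
                                    × HasOutput c (word output (f w)))

infix 4 _≤ₚ_

_≤ₚ_ : ∀ {A B} → Language A → Language B → Set₁
_≤ₚ_ {A} {B} L L′ =
  Σ[ f ∈ (List A → List B) ] (PolyTime f × (∀ w → L w ⇔ L′ (f w)))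

PSPACE-hard : ∀ {B} → Language B → Set₁
PSPACE-hard L′ = ∀ {A} → Finite A → (L : Language A) → PSPACE L → L ≤ₚ L′

{-# OPTIONS --safe #-}
-- The closed formulas atom i = ¬ (◇ⁱ⊤ ▷ ◇ⁱ⁺¹⊤) behave like independent propositional
-- variables: at a world w of rank at least i + 2 the value of atom i depends only on whether
-- S_w leads from rank i to rank i + 1, and the relations S_w can be chosen separately for
-- every w.  At the lowest worlds the model has at most one true atom each, so a pair of atoms
-- as premises excludes them.
--
-- With variables available, Savitch's halving is written as Horn clauses over a tree: a node
-- of level k carries the facts `old` about a configuration and the facts `new` about its
-- 2^k-th successor, and passes the two halves of that computation to children of level k - 1.
-- Tape cells are indexed relative to the head, which makes a machine step a shift.  If the
-- machine accepts, the clauses prove by induction on k that the root knows the accepting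
-- state; if it rejects, the tree of all dyadic subintervals of the run is a Veltman
-- countermodel.  Halting takes at most 2^m steps since configurations do not repeat.
--
-- In Polish notation the formula is a stream of clauses indexed by two unary counters, and is
-- written by a loop program on stacks, which a multitape Turing machine runs step by step.
module Submission where

open import Defs
open import Data.Bool using (Bool; _∧_; _∨_; false; if_then_else_; not; true)
import Data.Bool.Properties as Bool
open import Data.Empty using (⊥; ⊥-elim)
open import Data.Fin using (#_; Fin; combine; finToFun; fromℕ; fromℕ<; funToFin; remQuot; suc; toℕ; zero)
open import Data.Fin.Properties using (*↔×; +↔⊎; 1↔⊤; 2↔Bool)
import Data.Fin.Properties as Fin
open import Data.List using (List; []; _++_; _ʳ++_; _∷_; allFin; concatMap; foldr; length; map; replicate; reverse)
open import Data.List.Membership.Propositional using (_∈_; find; lose)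
open import Data.List.Membership.Propositional.Properties using (∈-++⁺ʳ; ∈-++⁺ˡ; ∈-++⁻; ∈-allFin; ∈-concatMap⁺; ∈-map⁺)
import Data.List.Properties as List
open import Data.List.Relation.Unary.All using (All; []; _∷_)
import Data.List.Relation.Unary.All as All
import Data.List.Relation.Unary.All.Properties as All
open import Data.List.Relation.Unary.Any using (Any; here; there)
import Data.List.Relation.Unary.Any as Any
open import Data.Maybe using (Maybe; fromMaybe; just; maybe′; nothing)
import Data.Maybe as Maybe
open import Data.Maybe.Properties using (just-injective)
open import Data.Nat using (NonZero; _*_; _+_; _<?_; _<_; _^_; _∸_; _≤?_; _≤_; suc; s≤s; zero; z≤n; ℕ)
import Data.Nat as ℕ
open import Data.Nat.DivMod
open import Data.Nat.Divisibility using (divides-refl)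
open import Data.Nat.Induction using (<-wellFounded)
open import Data.Nat.ListAction using (sum)
open import Data.Nat.Properties
open import Data.Nat.Tactic.RingSolver using (solve-∀)
open import Data.Product using (_,_; _×_; proj₁; proj₂; Σ; ∃-syntax)
import Data.Product as Product
open import Data.Product.Function.Dependent.Propositional using (Σ-↔)
open import Data.Product.Function.NonDependent.Propositional using (_×-↔_)
open import Data.Sum using ([_,_]′; _⊎_; inj₁; inj₂)
open import Data.Sum.Function.Propositional using (_⊎-↔_)
open import Data.Sum.Properties using (inj₁-injective; inj₂-injective)
open import Data.Unit using (tt; ⊤)
open import Data.Vec using (Vec; []; _[_]≔_; _∷_; lookup)
import Data.Vec as Vec
import Data.Vec.Properties as Vec
open import Function using (_∘_; id)
open import Function.Bundles using (Equivalence; Injection; Inverse; _↔_; _↣_; _⇔_; mk↔ₛ′; mk↣; mk⇔)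
open import Function.Properties.Inverse using (↔-refl; ↔-sym; ↔-trans)
open import Induction.WellFounded using (Acc; acc)
open import Relation.Binary.Definitions using (DecidableEquality)
open import Relation.Binary.PropositionalEquality
open import Relation.Nullary using (Dec; no; yes; ¬_)
open import Relation.Nullary.Decidable using (_×-dec_; _→-dec_; dec-false; dec-true; decidable-stable; does; map′)

-- Finite sets

-- A closed formula without ▷ can only see the rank of a world, so everything else that a closed
-- formula expresses has to come from ▷ and the relations S. No completeness theorem is involved.
-- Acceptance yields a derivation that treats the atoms as opaque formulas; rejection yields a
-- model, for which soundness suffices. What the atoms mean matters only there. An atom gets a free
-- value only at worlds with successors of two particular ranks, so the model cannot end at the
-- leaves of the computation tree: below each leaf hangs a tall tree of worlds whose atoms cannot
-- all be controlled. The clauses are boxed and must hold in those worlds too, which is why they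
-- carry guards. The machine is deterministic, so no midpoint has to be guessed. The clauses only
-- propagate facts of the actual run, so they hold in its model whatever the outcome; the outcome
-- enters only through the hypotheses that rule out accepting states. Hence acceptance itself,
-- rather than its complement, becomes provability.

finite-⊤ : Finite ⊤
finite-⊤ = 1 , ↔-sym 1↔⊤

finite-Bool : Finite Bool
finite-Bool = 2 , ↔-sym 2↔Bool

finite-Fin : ∀ n → Finite (Fin n)
finite-Fin n = n , ↔-refl

finite-⊎ : ∀ {A B} → Finite A → Finite B → Finite (A ⊎ B)
finite-⊎ (m , f) (n , g) = m + n , ↔-trans (f ⊎-↔ g) (↔-sym +↔⊎)

finite-× : ∀ {A B} → Finite A → Finite B → Finite (A × B)
finite-× (m , f) (n , g) = m * n , ↔-trans (f ×-↔ g) (↔-sym *↔×)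

finite-Maybe : ∀ {A} → Finite A → Finite (Maybe A)
finite-Maybe {A} (n , f) = suc n , ↔-trans ⊎↔ (proj₂ (finite-⊎ finite-⊤ (n , f)))
  where
  ⊎↔ : Maybe A ↔ (⊤ ⊎ A)
  ⊎↔ = mk↔ₛ′ (λ { nothing → inj₁ tt ; (just a) → inj₂ a })
             (λ { (inj₁ _) → nothing ; (inj₂ a) → just a })
             (λ { (inj₁ _) → refl ; (inj₂ _) → refl })
             (λ { nothing → refl ; (just _) → refl })

finite-ΣFin : ∀ n {B : Fin n → Set} → (∀ i → Finite (B i)) → Finite (Σ (Fin n) B)
finite-ΣFin zero    fin = 0 , mk↔ₛ′ (λ ()) (λ ()) (λ ()) (λ ())
finite-ΣFin (suc n) {B} fin with finite-⊎ (fin zero) (finite-ΣFin n (fin ∘ suc))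
... | m , f = m , ↔-trans split f
  where
  split : Σ (Fin (suc n)) B ↔ (B zero ⊎ Σ (Fin n) (B ∘ suc))
  split = mk↔ₛ′ (λ { (zero , b) → inj₁ b ; (suc i , b) → inj₂ (i , b) })
                (λ { (inj₁ b) → zero , b ; (inj₂ (i , b)) → suc i , b })
                (λ { (inj₁ _) → refl ; (inj₂ _) → refl })
                (λ { (zero , _) → refl ; (suc _ , _) → refl })

finite-Σ : ∀ {A} {B : A → Set} → Finite A → (∀ a → Finite (B a)) → Finite (Σ A B)
finite-Σ {B = B} (n , f) fin with finite-ΣFin n (fin ∘ Inverse.from f)
... | m , g = m , ↔-trans (↔-sym (Σ-↔ (↔-sym f) ↔-refl)) g

finite-Vec : ∀ {A} → Finite A → ∀ n → Finite (Vec A n)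
finite-Vec A-fin zero = 1 , mk↔ₛ′ (λ _ → zero) (λ _ → []) (λ { zero → refl }) (λ { [] → refl })
finite-Vec {A} A-fin (suc n) with m , f ← finite-× A-fin (finite-Vec A-fin n) = m , ↔-trans uncons f
  where
  uncons : Vec A (suc n) ↔ (A × Vec A n)
  uncons = mk↔ₛ′ (λ { (a ∷ as) → a , as }) (λ { (a , as) → a ∷ as }) (λ _ → refl) (λ { (_ ∷ _) → refl })

enum : ∀ {A} → Finite A → List A
enum (n , f) = map (Inverse.from f) (allFin n)

∈-enum : ∀ {A} (fin : Finite A) a → a ∈ enum fin
∈-enum (n , f) a = subst (_∈ enum (n , f)) (Inverse.strictlyInverseʳ f a)
                     (∈-map⁺ (Inverse.from f) (∈-allFin (Inverse.to f a)))

finite-≟ : ∀ {A} → Finite A → DecidableEquality A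
finite-≟ (n , f) a b = map′ injective (cong (Inverse.to f)) (Inverse.to f a Fin.≟ Inverse.to f b)
  where
  injective : Inverse.to f a ≡ Inverse.to f b → a ≡ b
  injective eq = trans (sym (Inverse.strictlyInverseʳ f a))
                       (trans (cong (Inverse.from f) eq) (Inverse.strictlyInverseʳ f b))

-- Polynomials

infixl 6 _+ᴾ_
infixl 7 _*ᴾ_

_+ᴾ_ : Polynomial → Polynomial → Polynomial
[]      +ᴾ q       = q
(a ∷ p) +ᴾ []      = a ∷ p
(a ∷ p) +ᴾ (b ∷ q) = a + b ∷ p +ᴾ q

_*ᴾ_ : Polynomial → Polynomial → Polynomial
[]      *ᴾ q = []
(a ∷ p) *ᴾ q = map (a *_) q +ᴾ (0 ∷ p *ᴾ q)

⟦+ᴾ⟧ : ∀ p q n → ⟦ p +ᴾ q ⟧ n ≡ ⟦ p ⟧ n + ⟦ q ⟧ n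
⟦+ᴾ⟧ []      q       n = refl
⟦+ᴾ⟧ (a ∷ p) []      n = sym (+-identityʳ _)
⟦+ᴾ⟧ (a ∷ p) (b ∷ q) n rewrite ⟦+ᴾ⟧ p q n = lemma a b n (⟦ p ⟧ n) (⟦ q ⟧ n)
  where
  lemma : ∀ a b n x y → a + b + n * (x + y) ≡ a + n * x + (b + n * y)
  lemma = solve-∀

⟦scale⟧ : ∀ a q n → ⟦ map (a *_) q ⟧ n ≡ a * ⟦ q ⟧ n
⟦scale⟧ a []      n = sym (*-zeroʳ a)
⟦scale⟧ a (b ∷ q) n rewrite ⟦scale⟧ a q n = lemma a b n (⟦ q ⟧ n)
  where
  lemma : ∀ a b n x → a * b + n * (a * x) ≡ a * (b + n * x)
  lemma = solve-∀

⟦*ᴾ⟧ : ∀ p q n → ⟦ p *ᴾ q ⟧ n ≡ ⟦ p ⟧ n * ⟦ q ⟧ n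
⟦*ᴾ⟧ []      q n = refl
⟦*ᴾ⟧ (a ∷ p) q n
  rewrite ⟦+ᴾ⟧ (map (a *_) q) (0 ∷ p *ᴾ q) n | ⟦scale⟧ a q n | ⟦*ᴾ⟧ p q n
  = lemma a n (⟦ p ⟧ n) (⟦ q ⟧ n)
  where
  lemma : ∀ a n x y → a * y + n * (x * y) ≡ (a + n * x) * y
  lemma = solve-∀

PolyBounded : (ℕ → ℕ) → Set
PolyBounded f = ∃[ p ] (∀ n → f n ≤ ⟦ p ⟧ n)

bounded-const : ∀ a → PolyBounded (λ _ → a)
bounded-const a = a ∷ [] , λ n → m≤m+n a _

bounded-id : PolyBounded (λ n → n)
bounded-id = 0 ∷ 1 ∷ [] , λ n → ≤-reflexive (lemma n)
  where
  lemma : ∀ n → n ≡ n * (1 + n * 0)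
  lemma = solve-∀

bounded-⟦⟧ : ∀ p → PolyBounded ⟦ p ⟧
bounded-⟦⟧ p = p , λ n → ≤-refl

bounded-+ : ∀ {f g} → PolyBounded f → PolyBounded g → PolyBounded (λ n → f n + g n)
bounded-+ (p , f≤) (q , g≤) =
  p +ᴾ q , λ n → ≤-trans (+-mono-≤ (f≤ n) (g≤ n)) (≤-reflexive (sym (⟦+ᴾ⟧ p q n)))

bounded-* : ∀ {f g} → PolyBounded f → PolyBounded g → PolyBounded (λ n → f n * g n)
bounded-* (p , f≤) (q , g≤) =
  p *ᴾ q , λ n → ≤-trans (*-mono-≤ (f≤ n) (g≤ n)) (≤-reflexive (sym (⟦*ᴾ⟧ p q n)))

-- Stack programs

module StackPrograms (X : Set) (X-fin : Finite X) (k : ℕ) where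

  Stacks : Set
  Stacks = Vec (List X) (suc k)

  infixr 5 _⨾_

  -- `while t p` pops the top z of stack t and runs p z, until t is empty.
  data Prog : Set where
    skip  : Prog
    push  : Fin (suc k) → X → Prog
    _⨾_   : Prog → Prog → Prog
    while : Fin (suc k) → (X → Prog) → Prog

  -- Control states.  In a loop, `inj₁ false` moves the head onto the top of
  -- the stack and `inj₁ true` inspects it.
  Pos : Prog → Set
  Pos skip        = ⊤
  Pos (push _ _)  = ⊤
  Pos (p ⨾ q)     = Pos p ⊎ Pos q
  Pos (while _ p) = Bool ⊎ Σ X (λ z → Pos (p z))

  entry : ∀ p → Pos p
  entry skip        = tt
  entry (push _ _)  = tt
  entry (p ⨾ _)     = inj₁ (entry p)
  entry (while _ _) = inj₁ false

  finite-Pos : ∀ p → Finite (Pos p)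
  finite-Pos skip        = finite-⊤
  finite-Pos (push _ _)  = finite-⊤
  finite-Pos (p ⨾ q)     = finite-⊎ (finite-Pos p) (finite-Pos q)
  finite-Pos (while _ p) = finite-⊎ finite-Bool (finite-Σ X-fin (λ z → finite-Pos (p z)))

  Cell : Set
  Cell = Maybe X

  Tps : Set
  Tps = Vec (Tape Cell) (suc k)

  Acts : Set
  Acts = Vec (Cell × Move) (suc k)

  idle : Vec Cell (suc k) → Acts
  idle = Vec.map (_, stay)

  on : Fin (suc k) → Cell × Move → Vec Cell (suc k) → Acts
  on t a cs = idle cs [ t ]≔ a

  -- The successor `nothing` means that the program is left.
  advance : ∀ p → Pos p → Vec Cell (suc k) → Maybe (Pos p) × Acts
  -- The scanned symbol is a separate argument, so that a proof which knows it only through an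
  -- equation can substitute it with `cong`.
  test  : ∀ t p → Maybe X → Vec Cell (suc k) → Maybe (Pos (while t p)) × Acts

  advance skip        _                cs = nothing , idle cs
  advance (push t z)  _                cs = nothing , on t (just z , right) cs
  advance (p ⨾ q)     (inj₁ a)         cs =
    Product.map₁ (just ∘ maybe′ inj₁ (inj₂ (entry q))) (advance p a cs)
  advance (p ⨾ q)     (inj₂ b)         cs = Product.map₁ (Maybe.map inj₂) (advance q b cs)
  advance (while t p) (inj₁ false)     cs = just (inj₁ true) , on t (nothing , left) cs
  advance (while t p) (inj₁ true)      cs = test t p (lookup cs t) cs
  advance (while t p) (inj₂ (z , a))   cs =
    Product.map₁ (just ∘ maybe′ (λ b → inj₂ (z , b)) (inj₁ false)) (advance (p z) a cs)

  -- The head has met the blank below the bottom and returns to the cell it came from.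
  test t p nothing  cs = nothing , on t (nothing , right) cs
  test t p (just z) cs = just (inj₂ (z , entry (p z))) , on t (nothing , stay) cs

  -- `moveHead` and `act` depend on the machine, hence on the program. These copies do not, so
  -- executions of different programs act on tapes by the same functions and can be joined;
  -- `act≗apply` relates the two versions.
  move : Move → Tape Cell → Tape Cell
  move stay  t                    = t
  move left  (tape []       a rs) = tape [] nothing (a ∷ rs)
  move left  (tape (l ∷ ls) a rs) = tape ls l (a ∷ rs)
  move right (tape ls a [])       = tape (a ∷ ls) nothing []
  move right (tape ls a (r ∷ rs)) = tape (a ∷ ls) r rs

  apply : Cell × Move → Tape Cell → Tape Cell
  apply (b , m) (tape ls _ rs) = move m (tape ls b rs)

  heads : Tps → Vec Cell (suc k)
  heads = Vec.map scanned

  data Exec (p : Prog) : Pos p → Tps → ℕ → Tps → Set where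
    exit : ∀ {a ts as} → advance p a (heads ts) ≡ (nothing , as) →
           Exec p a ts 1 (Vec.zipWith apply as ts)
    go   : ∀ {a b ts as n us} → advance p a (heads ts) ≡ (just b , as) →
           Exec p b (Vec.zipWith apply as ts) n us → Exec p a ts (suc n) us

  -- The machine step that leaves `p` is redirected to the entry of `q`, so joining two executions
  -- costs no extra step.
  exec-⨾ˡ : ∀ {p q a ts m us n vs} → Exec p a ts m us → Exec q (entry q) us n vs →
            Exec (p ⨾ q) (inj₁ a) ts (m + n) vs
  exec-⨾ʳ : ∀ {p q b ts n us} → Exec q b ts n us → Exec (p ⨾ q) (inj₂ b) ts n us

  exec-⨾ˡ {q = q} (exit eq) e = go (cong (Product.map₁ (just ∘ maybe′ inj₁ (inj₂ (entry q)))) eq) (exec-⨾ʳ e)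
  exec-⨾ˡ {q = q} (go eq d) e = go (cong (Product.map₁ (just ∘ maybe′ inj₁ (inj₂ (entry q)))) eq) (exec-⨾ˡ d e)

  exec-⨾ʳ (exit eq) = exit (cong (Product.map₁ (Maybe.map inj₂)) eq)
  exec-⨾ʳ (go eq d) = go (cong (Product.map₁ (Maybe.map inj₂)) eq) (exec-⨾ʳ d)

  exec-body : ∀ {t p z a ts m us n vs} → Exec (p z) a ts m us →
              Exec (while t p) (inj₁ false) us n vs →
              Exec (while t p) (inj₂ (z , a)) ts (m + n) vs
  exec-body {z = z} (exit eq) e =
    go (cong (Product.map₁ (just ∘ maybe′ (λ b → inj₂ (z , b)) (inj₁ false))) eq) e
  exec-body {z = z} (go eq d) e =
    go (cong (Product.map₁ (just ∘ maybe′ (λ b → inj₂ (z , b)) (inj₁ false))) eq) (exec-body d e)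

  zipWith-idle : ∀ {n} (ts : Vec (Tape Cell) n) →
                 Vec.zipWith apply (Vec.map (_, stay) (Vec.map scanned ts)) ts ≡ ts
  zipWith-idle []       = refl
  zipWith-idle (t ∷ ts) = cong (t ∷_) (zipWith-idle ts)

  zipWith-on : ∀ {n} t a (ts : Vec (Tape Cell) n) →
               Vec.zipWith apply (Vec.map (_, stay) (Vec.map scanned ts) [ t ]≔ a) ts
               ≡ ts [ t ]≔ apply a (lookup ts t)
  zipWith-on zero    a (t ∷ ts) = cong (_ ∷_) (zipWith-idle ts)
  zipWith-on (suc i) a (t ∷ ts) = cong (t ∷_) (zipWith-on i a ts)

  exit-on : ∀ {p a ts t b} → advance p a (heads ts) ≡ (nothing , on t b (heads ts)) →
            Exec p a ts 1 (ts [ t ]≔ apply b (lookup ts t))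
  exit-on {p} {a} {ts} {t} {b} eq = subst (Exec p a ts 1) (zipWith-on t b ts) (exit eq)

  go-on : ∀ {p a a′ ts t b n us} → advance p a (heads ts) ≡ (just a′ , on t b (heads ts)) →
          Exec p a′ (ts [ t ]≔ apply b (lookup ts t)) n us → Exec p a ts (suc n) us
  go-on {p} {a′ = a′} {ts} {t} {b} {n} {us} eq e =
    go eq (subst (λ vs → Exec p a′ vs n us) (sym (zipWith-on t b ts)) e)

  -- The head stands on the cell after the top; popping below the bottom
  -- leaves blank cells behind.
  data Holds : Tape Cell → List X → Set where
    stack : ∀ xs i j →
            Holds (tape (map just xs ++ replicate i nothing) nothing (replicate j nothing)) xs

  Rep : Tps → Stacks → Set
  Rep ts st = ∀ t → Holds (lookup ts t) (lookup st t)

  rep-≔ : ∀ {ts st} t {a xs} → Rep ts st → Holds a xs → Rep (ts [ t ]≔ a) (st [ t ]≔ xs)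
  rep-≔ {ts} {st} t {a} {xs} r h u with t Fin.≟ u
  ... | yes refl rewrite Vec.lookup∘update t ts a | Vec.lookup∘update t st xs = h
  ... | no t≢u rewrite Vec.lookup∘update′ (t≢u ∘ sym) ts a
                     | Vec.lookup∘update′ (t≢u ∘ sym) st xs = r u

  record Runs (p : Prog) (st : Stacks) (n : ℕ) (st′ : Stacks) : Set where
    constructor runs
    field
      execute : ∀ ts → Rep ts st →
                ∃[ m ] ∃[ us ] (m ≤ n × Exec p (entry p) ts m us × Rep us st′)

  open Runs

  weaken : ∀ {p st m n st′} → m ≤ n → Runs p st m st′ → Runs p st n st′
  execute (weaken m≤n r) ts rep with execute r ts rep
  ... | l , us , l≤m , e , rep′ = l , us , ≤-trans l≤m m≤n , e , rep′

  run-skip : ∀ {st} → Runs skip st 1 st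
  execute run-skip ts rep =
    1 , ts , ≤-refl , subst (Exec skip tt ts 1) (zipWith-idle ts) (exit refl) , rep

  run-push : ∀ {st} t z → Runs (push t z) st 1 (st [ t ]≔ (z ∷ lookup st t))
  execute (run-push {st} t z) ts rep =
    1 , _ , ≤-refl , exit-on refl , rep-≔ {ts} {st} t rep (pushed (rep t))
    where
    pushed : ∀ {a xs} → Holds a xs → Holds (apply (just z , right) a) (z ∷ xs)
    pushed (stack xs i zero)    = stack (z ∷ xs) i 0
    pushed (stack xs i (suc j)) = stack (z ∷ xs) i j

  run-⨾ : ∀ {p q st m st′ n st″} → Runs p st m st′ → Runs q st′ n st″ →
          Runs (p ⨾ q) st (m + n) st″
  execute (run-⨾ r s) ts rep with execute r ts rep
  ... | m , us , m≤ , d , rep′ with execute s us rep′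
  ... | n , vs , n≤ , e , rep″ = m + n , vs , +-mono-≤ m≤ n≤ , exec-⨾ˡ d e , rep″

  look-head : ∀ (ts : Tps) t a → lookup (heads (ts [ t ]≔ a)) t ≡ scanned a
  look-head ts t a = begin
    lookup (heads (ts [ t ]≔ a)) t      ≡⟨ Vec.lookup-map t scanned (ts [ t ]≔ a) ⟩
    scanned (lookup (ts [ t ]≔ a) t)    ≡⟨ cong scanned (Vec.lookup∘update t ts a) ⟩
    scanned a                           ∎
    where open ≡-Reasoning

  update-twice : ∀ (ts : Tps) t a (f : Tape Cell → Tape Cell) →
                 (ts [ t ]≔ a) [ t ]≔ f (lookup (ts [ t ]≔ a) t) ≡ ts [ t ]≔ f a
  update-twice ts t a f rewrite Vec.lookup∘update t ts a = Vec.[]≔-idempotent ts t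

  blank-below : ∀ {a} → Holds a [] → scanned (apply (nothing , left) a) ≡ nothing
  blank-below (stack [] zero    j) = refl
  blank-below (stack [] (suc i) j) = refl

  bounce : ∀ {a} → Holds a [] → Holds (apply (nothing , right) (apply (nothing , left) a)) []
  bounce (stack [] zero    j) = stack [] 1 j
  bounce (stack [] (suc i) j) = stack [] (suc i) j

  top : ∀ {a z xs} → Holds a (z ∷ xs) → scanned (apply (nothing , left) a) ≡ just z
  top (stack (z ∷ xs) i j) = refl

  pop : ∀ {a z xs} → Holds a (z ∷ xs) → Holds (apply (nothing , stay) (apply (nothing , left) a)) xs
  pop (stack (z ∷ xs) i j) = stack xs i (suc j)

  run-while-[] : ∀ {t p st} → lookup st t ≡ [] → Runs (while t p) st 2 st
  execute (run-while-[] {t} {p} {st} eq) ts rep =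
    2 , _ , ≤-refl ,
    go-on refl (subst (Exec (while t p) (inj₁ true) ts₁ 1)
      (update-twice ts t _ (apply (nothing , right)))
      (exit-on (cong (λ c → test t p c (heads ts₁)) looked))) ,
    subst (Rep (ts [ t ]≔ apply (nothing , right) (apply (nothing , left) (lookup ts t)))) unchanged (rep-≔ {ts} {st} t rep (bounce holds))
    where
    ts₁ = ts [ t ]≔ apply (nothing , left) (lookup ts t)
    holds : Holds (lookup ts t) []
    holds = subst (Holds (lookup ts t)) eq (rep t)
    looked : lookup (heads ts₁) t ≡ nothing
    looked = trans (look-head ts t _) (blank-below holds)
    unchanged : st [ t ]≔ [] ≡ st
    unchanged = subst (λ xs → st [ t ]≔ xs ≡ st) eq (Vec.[]≔-lookup st t)

  run-while-∷ : ∀ {t p st z xs m st₁ n st₂} → lookup st t ≡ z ∷ xs →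
                Runs (p z) (st [ t ]≔ xs) m st₁ → Runs (while t p) st₁ n st₂ →
                Runs (while t p) st (2 + (m + n)) st₂
  execute (run-while-∷ {t} {p} {st} {z} {xs} eq r s) ts rep
    with holds ← subst (Holds (lookup ts t)) eq (rep t)
    with m , us , m≤ , d , rep₁ ← execute r _ (rep-≔ {ts} {st} t rep (pop holds))
    with n , vs , n≤ , e , rep₂ ← execute s us rep₁ =
    2 + (m + n) , vs , s≤s (s≤s (+-mono-≤ m≤ n≤)) ,
    go-on refl (go-on (cong (λ c → test t p c (heads ts₁)) (trans (look-head ts t _) (top holds)))
      (subst (λ ws → Exec (while t p) _ ws (m + n) vs)
        (sym (update-twice ts t _ (apply (nothing , stay)))) (exec-body d e))) ,
    rep₂
    where
    ts₁ = ts [ t ]≔ apply (nothing , left) (lookup ts t)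

  -- From stack programs to Turing machines

  data Phase (p : Prog) : Set where
    load : Phase p
    at   : Pos p → Phase p
    stop : Phase p

  finite-Phase : ∀ p → Finite (Phase p)
  finite-Phase p with n , f ← finite-Maybe (finite-Maybe (finite-Pos p)) = n , ↔-trans g f
    where
    g : Phase p ↔ Maybe (Maybe (Pos p))
    g = mk↔ₛ′ (λ { load → nothing ; stop → just nothing ; (at a) → just (just a) })
              (λ { nothing → load ; (just nothing) → stop ; (just (just a)) → at a })
              (λ { nothing → refl ; (just nothing) → refl ; (just (just _)) → refl })
              (λ { load → refl ; stop → refl ; (at _) → refl })

  delta : ∀ p → Phase p → Vec Cell (suc k) → Maybe (Phase p × Acts)
  delta p load   cs@(just z  ∷ _) = just (load , on zero (just z , right) cs)
  delta p load   cs@(nothing ∷ _) = just (at (entry p) , idle cs)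
  delta p (at a) cs               = just (Product.map₁ (maybe′ at stop) (advance p a cs))
  delta p stop   cs               = nothing

  -- The input head starts at the left end of the word; `load` takes it to the
  -- right end, which makes the input a stack.
  compile : Prog → Machine
  compile p = record
    { k = k ; Q = Phase p ; Q-fin = finite-Phase p ; Γ = Cell ; Γ-fin = finite-Maybe X-fin
    ; blank = nothing ; start = load ; δ = delta p }

  module _ (p : Prog) where
    open Machine (compile p) hiding (k)

    act≗apply : ∀ a t → act a t ≡ apply a t
    act≗apply (b , stay)  (tape _       _ _)       = refl
    act≗apply (b , left)  (tape []      _ _)       = refl
    act≗apply (b , left)  (tape (_ ∷ _) _ _)       = refl
    act≗apply (b , right) (tape _       _ [])      = refl
    act≗apply (b , right) (tape _       _ (_ ∷ _)) = refl

    zipWith-act : ∀ {n} (as : Vec (Cell × Move) n) ts → Vec.zipWith act as ts ≡ Vec.zipWith apply as ts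
    zipWith-act []       []       = refl
    zipWith-act (a ∷ as) (t ∷ ts) = cong₂ _∷_ (act≗apply a t) (zipWith-act as ts)

    exec⇒↝ : ∀ {a ts n us} → Exec p a ts n us → (at a , ts) ↝[ n ] (stop , us)
    exec⇒↝ {ts = ts} (exit {as = as} eq) rewrite sym (zipWith-act as ts) =
      next (cong (λ r → just (maybe′ at stop (proj₁ r) , Vec.zipWith act (proj₂ r) ts)) eq) done
    exec⇒↝ {ts = ts} (go {as = as} eq e) rewrite sym (zipWith-act as ts) =
      next (cong (λ r → just (maybe′ at stop (proj₁ r) , Vec.zipWith act (proj₂ r) ts)) eq) (exec⇒↝ e)

    load-step : ∀ ls z rs (ts : Vec (Tape Cell) k) →
                step (load , tape ls (just z) rs ∷ ts)
                ≡ just (load , apply (just z , right) (tape ls (just z) rs) ∷ ts)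
    load-step ls z rs ts = cong (λ us → just (load , us))
      (trans (zipWith-act (on zero (just z , right) (heads (tape ls (just z) rs ∷ ts))) (tape ls (just z) rs ∷ ts))
             (zipWith-on zero _ (tape ls (just z) rs ∷ ts)))

    load-run : ∀ xs z ys (ts : Vec (Tape Cell) k) →
               (load , tape (map just xs) (just z) (map just ys) ∷ ts)
               ↝[ suc (length ys) ] (load , tape (map just ((z ∷ ys) ʳ++ xs)) nothing [] ∷ ts)
    load-run xs z []       ts = next (load-step (map just xs) z [] ts) done
    load-run xs z (y ∷ ys) ts = next (load-step (map just xs) z (map just (y ∷ ys)) ts) (load-run (z ∷ xs) y ys ts)

    load-done : ∀ ls rs (ts : Vec (Tape Cell) k) →
                step (load , tape ls nothing rs ∷ ts) ≡ just (at (entry p) , tape ls nothing rs ∷ ts)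
    load-done ls rs ts = cong (λ us → just (at (entry p) , us))
      (trans (zipWith-act (idle (heads (tape ls nothing rs ∷ ts))) (tape ls nothing rs ∷ ts))
             (zipWith-idle (tape ls nothing rs ∷ ts)))

    _◅◅_ : ∀ {c d e m n} → c ↝[ m ] d → d ↝[ n ] e → c ↝[ m + n ] e
    done     ◅◅ e = e
    next s d ◅◅ e = next s (d ◅◅ e)

    loaded : List X → Tps
    loaded w = tape (map just (reverse w)) nothing [] ∷ Vec.replicate k emptyTape

    load↝ : ∀ w → initial (map just w) ↝[ length w + 1 ] (at (entry p) , loaded w)
    load↝ []      = next (load-done [] [] _) done
    load↝ (z ∷ w) = load-run [] z w _ ◅◅ next (load-done _ [] _) done

    rep-loaded : ∀ w → Rep (loaded w) (reverse w ∷ Vec.replicate k [])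
    rep-loaded w zero    = subst (λ ls → Holds (tape ls nothing []) (reverse w)) (List.++-identityʳ _) (stack (reverse w) 0 0)
    rep-loaded w (suc i) rewrite Vec.lookup-replicate {n = k} i emptyTape | Vec.lookup-replicate {n = k} i (List.[] {A = X}) = stack [] 0 0

  replicate-snoc : ∀ {A : Set} n (a : A) → replicate n a ++ a ∷ [] ≡ a ∷ replicate n a
  replicate-snoc zero    a = refl
  replicate-snoc (suc n) a = cong (a ∷_) (replicate-snoc n a)

  reverse-replicate : ∀ {A : Set} n (a : A) → reverse (replicate n a) ≡ replicate n a
  reverse-replicate zero    a = refl
  reverse-replicate (suc n) a = begin
    reverse (a ∷ replicate n a)      ≡⟨ List.unfold-reverse a (replicate n a) ⟩
    reverse (replicate n a) ++ a ∷ [] ≡⟨ cong (_++ a ∷ []) (reverse-replicate n a) ⟩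
    replicate n a ++ a ∷ []          ≡⟨ replicate-snoc n a ⟩
    a ∷ replicate n a                ∎
    where open ≡-Reasoning

  -- Two reversals cancel: a word printed from left to right has its last symbol on top of the
  -- stack, and a tape lists the cells before the head nearest first.
  cells-stack : ∀ {a} xs → Holds a (reverse xs) →
                ∃[ i ] ∃[ j ] cells a ≡ replicate i nothing ++ map just xs ++ replicate j nothing
  cells-stack xs (stack _ i j) = i , suc j , (begin
    reverse (map just (reverse xs) ++ bs) ++ nothing ∷ replicate j nothing
      ≡⟨ cong (_++ nothing ∷ replicate j nothing) (List.reverse-++ (map just (reverse xs)) bs) ⟩
    (reverse bs ++ reverse (map just (reverse xs))) ++ nothing ∷ replicate j nothing
      ≡⟨ cong₂ (λ l r → (l ++ r) ++ nothing ∷ replicate j nothing) (reverse-replicate i nothing)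
           (trans (sym (List.reverse-map just (reverse xs))) (cong (map just) (List.reverse-involutive xs))) ⟩
    (bs ++ map just xs) ++ nothing ∷ replicate j nothing
      ≡⟨ List.++-assoc bs (map just xs) _ ⟩
    bs ++ map just xs ++ replicate (suc j) nothing ∎)
    where
    open ≡-Reasoning
    bs = replicate i nothing

  last≡lookup : ∀ {A : Set} {n} (xs : Vec A (suc n)) → Vec.last xs ≡ lookup xs (fromℕ n)
  last≡lookup (z ∷ [])     = refl
  last≡lookup (z ∷ y ∷ xs) = last≡lookup (y ∷ xs)

  embedding : ∀ {A} → A ↣ X → ∀ p → Machine.Embeds (compile p) A
  embedding ι p = mk↣ (λ eq → Injection.injective ι (just-injective eq)) , λ _ ()

  polyTime : ∀ {A B} {f : List A → List B} (ιA : A ↣ X) (ιB : B ↣ X) p {cost} → PolyBounded cost →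
             (∀ w → ∃[ st ] (Runs p (reverse (map (Injection.to ιA) w) ∷ Vec.replicate k []) (cost (length w)) st
                            × Vec.last st ≡ reverse (map (Injection.to ιB) (f w)))) →
             PolyTime f
  polyTime {f = f} ιA ιB p {cost} cost-bounded spec = record
    { machine  = compile p
    ; input    = embedding ιA p
    ; output   = embedding ιB p
    ; bound    = proj₁ total
    ; computes = computes′
    }
    where
    open Machine (compile p) hiding (k)
    total : PolyBounded (λ n → n + 1 + cost n)
    total = bounded-+ (bounded-+ bounded-id (bounded-const 1)) cost-bounded
    computes′ : ∀ w → ∃[ t ] ∃[ c ] (t ≤ ⟦ proj₁ total ⟧ (length w)
                  × initial (word (embedding ιA p) w) ↝[ t ] c × Halted c
                  × HasOutput c (word (embedding ιB p) (f w)))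
    computes′ w with st , r , out ← spec w
                with m , us , m≤ , e , rep ← execute r _ (rep-loaded p (map (Injection.to ιA) w)) =
      length (map (Injection.to ιA) w) + 1 + m , (stop , us) ,
      ≤-trans (+-mono-≤ (≤-reflexive (cong (_+ 1) (List.length-map (Injection.to ιA) w))) m≤)
              (proj₂ total (length w)) ,
      subst (λ v → initial v ↝[ length (map (Injection.to ιA) w) + 1 + m ] (stop , us)) (sym (List.map-∘ w))
        (_◅◅_ p (load↝ p _) (exec⇒↝ p e)) ,
      refl ,
      subst (λ v → ∃[ i ] ∃[ j ] cells (Vec.last us) ≡ replicate i nothing ++ v ++ replicate j nothing)
        (sym (List.map-∘ (f w)))
        (cells-stack (map (Injection.to ιB) (f w)) (subst₂ Holds (sym (last≡lookup us))
          (trans (sym (last≡lookup st)) out) (rep (fromℕ k))))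

-- Theories

-- This gives the Hilbert system the comfort of natural deduction: `⊕` makes an assumption by
-- prefixing it to every formula, and `unbox` enters a box. Membership in a nested theory unfolds by
-- definition to membership of a longer formula in the outer one.
record Theory : Set₁ where
  field
    Mem  : Formula → Set
    thm  : ∀ {A} → IL⊢ A → Mem A
    _·_  : ∀ {A B} → Mem (A ⇒ B) → Mem A → Mem B
  infixl 5 _·_

open Theory using (Mem)

IL : Theory
IL = record { Mem = IL⊢_ ; thm = id ; _·_ = mp }

unbox : Theory → Theory
unbox T = record { Mem = λ A → Mem T (□ A) ; thm = thm ∘ nec ; _·_ = λ f a → thm K · f · a }
  where open Theory T hiding (Mem)

⊢const : ∀ {A B} → IL⊢ A ⇒ B ⇒ A
⊢const {A} {B} = taut λ v → lemma (eval v A) (eval v B)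
  where
  lemma : ∀ a b → not a ∨ (not b ∨ a) ≡ true
  lemma false _     = refl
  lemma true  false = refl
  lemma true  true  = refl

⊢ap : ∀ {A B C} → IL⊢ (A ⇒ B ⇒ C) ⇒ (A ⇒ B) ⇒ A ⇒ C
⊢ap {A} {B} {C} = taut λ v → lemma (eval v A) (eval v B) (eval v C)
  where
  lemma : ∀ a b c → not (not a ∨ (not b ∨ c)) ∨ (not (not a ∨ b) ∨ (not a ∨ c)) ≡ true
  lemma false _     _     = refl
  lemma true  false _     = refl
  lemma true  true  false = refl
  lemma true  true  true  = refl

⊢id : ∀ {A} → IL⊢ A ⇒ A
⊢id {A} = taut λ v → lemma (eval v A)
  where
  lemma : ∀ a → not a ∨ a ≡ true
  lemma false = refl
  lemma true  = refl

⊢pair : ∀ {A B} → IL⊢ A ⇒ B ⇒ A ∧ᶠ B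
⊢pair {A} {B} = taut λ v → lemma (eval v A) (eval v B)
  where
  lemma : ∀ a b → not a ∨ (not b ∨ (not (not a ∨ (not b ∨ false)) ∨ false)) ≡ true
  lemma false _     = refl
  lemma true  false = refl
  lemma true  true  = refl

⊢fst : ∀ {A B} → IL⊢ A ∧ᶠ B ⇒ A
⊢fst {A} {B} = taut λ v → lemma (eval v A) (eval v B)
  where
  lemma : ∀ a b → not (not (not a ∨ (not b ∨ false)) ∨ false) ∨ a ≡ true
  lemma false _     = refl
  lemma true  false = refl
  lemma true  true  = refl

⊢snd : ∀ {A B} → IL⊢ A ∧ᶠ B ⇒ B
⊢snd {A} {B} = taut λ v → lemma (eval v A) (eval v B)
  where
  lemma : ∀ a b → not (not (not a ∨ (not b ∨ false)) ∨ false) ∨ b ≡ true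
  lemma false _     = refl
  lemma true  false = refl
  lemma true  true  = refl

infixl 6 _⊕_

_⊕_ : Theory → Formula → Theory
T ⊕ A = record
  { Mem = λ B → Mem T (A ⇒ B)
  ; thm = λ p → thm ⊢const · thm p
  ; _·_ = λ f a → thm ⊢ap · f · a
  }
  where open Theory T hiding (Mem)

infix 4 _⊆_

_⊆_ : Theory → Theory → Set
T ⊆ U = ∀ {A} → Mem T A → Mem U A

⊕-⊆ : ∀ T A → T ⊆ (T ⊕ A)
⊕-⊆ T A p = thm ⊢const · p
  where open Theory T hiding (Mem)

⊕-∈ : ∀ T A → Mem (T ⊕ A) A
⊕-∈ T A = Theory.thm T ⊢id

-- The continuation works in an arbitrary extension, so the theory with all assumptions added one by
-- one never has to be named.
discharge : ∀ T As {B} → (∀ U → T ⊆ U → All (Mem U) As → Mem U B) → Mem T (foldr _⇒_ B As)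
discharge T []       h = h T id []
discharge T (A ∷ As) h = discharge (T ⊕ A) As λ U T⊕A⊆U As∈U →
  h U (λ p → T⊕A⊆U (⊕-⊆ T A p)) (T⊕A⊆U (⊕-∈ T A) ∷ As∈U)

-- Löb's axiom applied to A ∧ □ A.
box-4 : ∀ T {A} → Mem T (□ A) → Mem T (□ □ A)
box-4 T {A} □A = thm K · thm (nec ⊢snd) · (thm Löb · step)
  where
  open Theory T hiding (Mem)
  B = A ∧ᶠ □ A
  U = unbox T ⊕ □ B
  module U = Theory U
  A∈U : Mem U A
  A∈U = ⊕-⊆ (unbox T) (□ B) □A
  □A∈U : Mem U (□ A)
  □A∈U = U.thm K U.· U.thm (nec ⊢fst) U.· ⊕-∈ (unbox T) (□ B)
  step : Mem U B
  step = U.thm ⊢pair U.· A∈U U.· □A∈U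

-- Veltman models

-- Finite lists of successors and a decidable S make forcing decidable, which supplies the classical
-- reasoning for tautologies and defined connectives; `rank` gives the converse well-foundedness for
-- Löb's axiom. `S w` is a preorder on all worlds, but ▷ only compares successors of w.
record Frame : Set₁ where
  field
    World     : Set
    succs     : World → List World
    rank      : World → ℕ
    S         : World → World → World → Set
    S?        : ∀ w u v → Dec (S w u v)
    rank-<    : ∀ {w u} → u ∈ succs w → rank u < rank w
    R-trans   : ∀ {w u v} → u ∈ succs w → v ∈ succs u → v ∈ succs w
    S-refl    : ∀ {w u} → S w u u
    S-trans   : ∀ {w u v t} → S w u v → S w v t → S w u t
    R⊆S       : ∀ {w u v} → v ∈ succs u → S w u v

module Forcing (F : Frame) where
  open Frame F

  infix 3 _⊩_ _⊩?_

  _⊩_ : World → Formula → Set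
  -- A derivation of a closed formula may pass through formulas with variables, so soundness needs
  -- some value for them.
  w ⊩ var _   = ⊥
  w ⊩ ⊥ᶠ      = ⊥
  w ⊩ (A ⇒ B) = w ⊩ A → w ⊩ B
  w ⊩ (□ A)   = All (λ u → u ⊩ A) (succs w)
  w ⊩ (A ▷ B) = All (λ u → u ⊩ A → Any (λ v → S w u v × (v ⊩ B)) (succs w)) (succs w)

  _⊩?_ : ∀ w A → Dec (w ⊩ A)
  w ⊩? var _   = no λ ()
  w ⊩? ⊥ᶠ      = no λ ()
  w ⊩? (A ⇒ B) = (w ⊩? A) →-dec (w ⊩? B)
  w ⊩? (□ A)   = All.all? (λ u → u ⊩? A) (succs w)
  w ⊩? (A ▷ B) =
    All.all? (λ u → (u ⊩? A) →-dec Any.any? (λ v → S? w u v ×-dec (v ⊩? B)) (succs w)) (succs w)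

  -- Forcing at a fixed world respects ⊥ and ⇒; once decided, it is one of the Boolean valuations
  -- over which `Tautology` quantifies.
  eval-does : ∀ w A → eval (λ B → does (w ⊩? B)) A ≡ does (w ⊩? A)
  eval-does w (var _) = refl
  eval-does w ⊥ᶠ      = refl
  eval-does w (A ⇒ B) = cong₂ (λ a b → not a ∨ b) (eval-does w A) (eval-does w B)
  eval-does w (□ A)   = refl
  eval-does w (A ▷ B) = refl

  taut-sound : ∀ A → Tautology A → ∀ w → w ⊩ A
  taut-sound A t w with w ⊩? A | trans (sym (eval-does w A)) (t _)
  ... | yes p | _ = p

  ⊩-∧ : ∀ {w A B} → w ⊩ (A ∧ᶠ B) → (w ⊩ A) × (w ⊩ B)
  ⊩-∧ {w} {A} {B} h =
    decidable-stable (w ⊩? A) (λ ¬a → h (λ a → ⊥-elim (¬a a))) ,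
    decidable-stable (w ⊩? B) (λ ¬b → h (λ _ → ¬b))

  löb-sound : ∀ {A} w → Acc _<_ (rank w) → w ⊩ (□ (□ A ⇒ A)) → w ⊩ (□ A)
  löb-sound {A} w (acc rs) h = All.tabulate λ {u} u∈ → All.lookup h u∈
    (löb-sound u (rs (rank-< u∈)) (All.tabulate λ v∈ → All.lookup h (R-trans u∈ v∈)))

  sound : ∀ {A} → IL⊢ A → ∀ w → w ⊩ A
  sound (taut {A} t) w = taut-sound A t w
  sound K w h a = All.zipWith (λ (f , b) → f b) (h , a)
  sound Löb w h = löb-sound w (<-wellFounded _) h
  sound J1 w h = All.tabulate λ u∈ a → lose u∈ (S-refl , All.lookup h u∈ a)
  sound (J2 {A} {B} {C}) w h with ab , bc ← ⊩-∧ {w} {A ▷ B} {B ▷ C} h =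
    All.tabulate λ u∈ a →
      let v , v∈ , uSv , b = find (All.lookup ab u∈ a)
          t , t∈ , vSt , c = find (All.lookup bc v∈ b)
      in lose t∈ (S-trans uSv vSt , c)
  sound (J3 {A} {B} {C}) w h with ac , bc ← ⊩-∧ {w} {A ▷ C} {B ▷ C} h = All.tabulate cases
    where
    cases : ∀ {u} → u ∈ succs w → u ⊩ (A ∨ᶠ B) → Any (λ v → S w u v × (v ⊩ C)) (succs w)
    cases {u} u∈ h′ with u ⊩? A
    ... | yes a = All.lookup ac u∈ a
    ... | no ¬a = All.lookup bc u∈ (h′ ¬a)
  sound J4 w h ◇a □¬b = ◇a (All.tabulate λ u∈ a →
    let _ , v∈ , _ , b = find (All.lookup h u∈ a) in All.lookup □¬b v∈ b)
  sound (J5 {A}) w = All.tabulate some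
    where
    some : ∀ {u} → u ∈ succs w → u ⊩ (◇ A) → Any (λ v → S w u v × (v ⊩ A)) (succs w)
    some {u} u∈ ◇a with Any.any? (λ v → v ⊩? A) (succs u)
    ... | yes p = let v , v∈ , a = find p in lose (R-trans u∈ v∈) (R⊆S v∈ , a)
    ... | no ¬p = ⊥-elim (◇a (All.tabulate λ v∈ a → ¬p (lose v∈ a)))
  sound (mp f a) w = sound f w (sound a w)
  sound (nec a) w = All.tabulate λ {u} _ → sound a u

  ⊩-foldr : ∀ {w B} As → w ⊩ foldr _⇒_ B As → All (w ⊩_) As → w ⊩ B
  ⊩-foldr []       b []         = b
  ⊩-foldr (A ∷ As) f (a ∷ as)   = ⊩-foldr As (f a) as

-- Closed formulas that behave like propositional variables

□^⊥ : ℕ → Formula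
□^⊥ zero    = ⊥ᶠ
□^⊥ (suc i) = □ (□^⊥ i)

-- The ◇ⁱ⊤ of the overview without the double negations between its boxes, so that the boxes are
-- printed as one block.
high : ℕ → Formula
high i = ¬ᶠ (□^⊥ i)

atom : ℕ → Formula
atom i = ¬ᶠ (high i ▷ high (suc i))

record Node : Set where
  constructor node
  field
    rank : ℕ
    time : ℕ
    side : Bool

-- A node of rank r stands for the time interval [time , time + width r].
module Model (width : ℕ → ℕ) (val : Node → ℕ → Bool) where
  open Node

  below : ℕ → ℕ → List Node
  below zero    τ = []
  below (suc r) τ =
    node r τ false ∷ node r (τ + width r) true ∷ below r τ ++ below r (τ + width r)

  below-rank : ∀ r τ {u} → u ∈ below r τ → rank u < r
  below-rank (suc r) τ (here refl)         = ≤-refl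
  below-rank (suc r) τ (there (here refl)) = ≤-refl
  below-rank (suc r) τ (there (there u∈))  =
    [ m≤n⇒m≤1+n ∘ below-rank r τ , m≤n⇒m≤1+n ∘ below-rank r _ ]′ (∈-++⁻ (below r τ) u∈)

  below-trans : ∀ r τ {u v} → u ∈ below r τ → v ∈ below (rank u) (time u) → v ∈ below r τ
  below-trans (suc r) τ (here refl)         v∈ = there (there (∈-++⁺ˡ v∈))
  below-trans (suc r) τ (there (here refl)) v∈ = there (there (∈-++⁺ʳ (below r τ) v∈))
  below-trans (suc r) τ (there (there u∈))  v∈ = there (there
    ([ (λ u∈ˡ → ∈-++⁺ˡ (below-trans r τ u∈ˡ v∈))
     , (λ u∈ʳ → ∈-++⁺ʳ (below r τ) (below-trans r _ u∈ʳ v∈)) ]′ (∈-++⁻ (below r τ) u∈)))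

  -- The number of indices below l that are true at w. The frame lets `S w` lead from u to v when
  -- the height at the rank of v is no greater than at the rank of u: a preorder that always permits
  -- going down. Climbing from rank i to rank i + 1 is possible exactly when index i is false at w,
  -- and this bit is what `atom i` reads off.
  height : Node → ℕ → ℕ
  height w zero    = 0
  height w (suc l) = if val w l then suc (height w l) else height w l

  height-suc : ∀ w l → height w l ≤ height w (suc l)
  height-suc w l with val w l
  ... | true  = n≤1+n _
  ... | false = ≤-refl

  height-mono : ∀ w {l m} → l ≤ m → height w l ≤ height w m
  height-mono w {m = zero}  z≤n = ≤-refl
  height-mono w {l} {suc m} l≤ with m≤n⇒m<n∨m≡n l≤
  ... | inj₁ (s≤s l≤m) = ≤-trans (height-mono w l≤m) (height-suc w m)
  ... | inj₂ refl      = ≤-refl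

  frame : Frame
  frame = record
    { World   = Node
    ; succs   = λ w → below (rank w) (time w)
    ; rank    = rank
    ; S       = λ w u v → height w (rank v) ≤ height w (rank u)
    ; S?      = λ w u v → _ ≤? _
    ; rank-<  = λ {w} → below-rank (rank w) (time w)
    ; R-trans = λ {w} → below-trans (rank w) (time w)
    ; S-refl  = ≤-refl
    ; S-trans = λ uSv vSt → ≤-trans vSt uSv
    ; R⊆S     = λ {w} {u} v∈ → height-mono w (<⇒≤ (below-rank (rank u) (time u) v∈))
    }

  open Forcing frame public

  of-rank : ∀ r τ {i} → i < r → ∃[ u ] (u ∈ below r τ × rank u ≡ i)
  of-rank (suc r) τ (s≤s i≤r) with m≤n⇒m<n∨m≡n i≤r
  ... | inj₂ refl = _ , here refl , refl
  ... | inj₁ i<r with u , u∈ , eq ← of-rank r τ i<r = u , there (there (∈-++⁺ˡ u∈)) , eq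

  □^⊥⇒ : ∀ i w → w ⊩ □^⊥ i → rank w < i
  □^⊥⇒ (suc i) (node zero    τ s) h       = s≤s z≤n
  □^⊥⇒ (suc i) (node (suc r) τ s) (h ∷ _) = s≤s (□^⊥⇒ i _ h)

  ⇒□^⊥ : ∀ i w → rank w < i → w ⊩ □^⊥ i
  ⇒□^⊥ (suc i) w (s≤s r≤i) =
    All.tabulate λ {u} u∈ → ⇒□^⊥ i u (<-≤-trans (below-rank (rank w) (time w) u∈) r≤i)

  high⇒ : ∀ i w → w ⊩ high i → i ≤ rank w
  high⇒ i w h = ≮⇒≥ (λ r<i → h (⇒□^⊥ i w r<i))

  ⇒high : ∀ i w → i ≤ rank w → w ⊩ high i
  ⇒high i w i≤r h = <⇒≱ (□^⊥⇒ i w h) i≤r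

  -- At rank i or lower no successor satisfies `high i`, so the negated ▷ would hold vacuously.
  atom⇒rank : ∀ i w → w ⊩ atom i → i < rank w
  atom⇒rank i w h with suc i ≤? rank w
  ... | yes i<r = i<r
  ... | no  i≮r = ⊥-elim (h (All.tabulate λ {u} u∈ hu →
    ⊥-elim (i≮r (≤-<-trans (high⇒ i u hu) (below-rank (rank w) (time w) u∈)))))

  -- A successor of rank i refutes the ▷: the height jumps at i + 1 and never falls again, so `S w`
  -- leads from it to no rank above i.
  val⇒atom : ∀ i w → suc i < rank w → val w i ≡ true → w ⊩ atom i
  val⇒atom i w 1+i<r eq h with u , u∈ , refl ← of-rank (rank w) (time w) (<-trans (n<1+n i) 1+i<r)
    with v , v∈ , uSv , hv ← find (All.lookup h u∈ (⇒high i u ≤-refl)) =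
    1+n≰n (≤-trans (≤-reflexive (sym height-jump)) (≤-trans (height-mono w (high⇒ (suc i) v hv)) uSv))
    where
    height-jump : height w (suc i) ≡ suc (height w i)
    height-jump rewrite eq = refl

  -- If the heights at i and i + 1 agree, a successor of rank exactly i is led to one of rank i + 1,
  -- which exists because `suc i < rank w`; successors of higher rank are their own witnesses.
  atom⇒val : ∀ i w → suc i < rank w → w ⊩ atom i → val w i ≡ true
  atom⇒val i w 1+i<r h with val w i in eq
  ... | true  = refl
  ... | false = ⊥-elim (h (All.tabulate step))
    where
    same : height w (suc i) ≡ height w i
    same rewrite eq = refl
    step : ∀ {u} → u ∈ below (rank w) (time w) → u ⊩ high i →
           Any (λ v → height w (rank v) ≤ height w (rank u) × (v ⊩ high (suc i))) (below (rank w) (time w))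
    step {u} u∈ hu with m≤n⇒m<n∨m≡n (high⇒ i u hu)
    ... | inj₁ i<r  = lose u∈ (≤-refl , ⇒high (suc i) u i<r)
    ... | inj₂ refl with v , v∈ , eqv ← of-rank (rank w) (time w) 1+i<r =
      lose v∈ (≤-reflexive (trans (cong (height w) eqv) same) , ⇒high (suc i) v (≤-reflexive (sym eqv)))

-- Unique readability

-- Arbitrary tails express that codes are prefix-free, which the induction needs for the first of
-- two arguments. Closedness is essential: `x` followed by `tick` is the code of one variable, but
-- also that of another with the tail `tick`.
encode-injective : ∀ A B {u v} → Closed A → Closed B → encode A ++ u ≡ encode B ++ v → A ≡ B × u ≡ v
encode-injective ⊥ᶠ ⊥ᶠ _ _ eq = refl , List.∷-injectiveʳ eq
encode-injective (A ⇒ A′) (B ⇒ B′) {u} {v} (a , a′) (b , b′) eq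
  with refl , eq′ ← encode-injective A B a b (trans (sym (List.++-assoc (encode A) (encode A′) u))
                      (trans (List.∷-injectiveʳ eq) (List.++-assoc (encode B) (encode B′) v)))
  with refl , eq″ ← encode-injective A′ B′ a′ b′ eq′ = refl , eq″
encode-injective (□ A) (□ B) a b eq with refl , eq′ ← encode-injective A B a b (List.∷-injectiveʳ eq) = refl , eq′
encode-injective (A ▷ A′) (B ▷ B′) {u} {v} (a , a′) (b , b′) eq
  with refl , eq′ ← encode-injective A B a b (trans (sym (List.++-assoc (encode A) (encode A′) u))
                      (trans (List.∷-injectiveʳ eq) (List.++-assoc (encode B) (encode B′) v)))
  with refl , eq″ ← encode-injective A′ B′ a′ b′ eq′ = refl , eq″

-- Templates and their generation

finite-Symbol : Finite Symbol
finite-Symbol = 6 , mk↔ₛ′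
  (λ { bot → # 0 ; imp → # 1 ; box → # 2 ; rhd → # 3 ; x → # 4 ; tick → # 5 })
  (λ { zero → bot ; (suc zero) → imp ; (suc (suc zero)) → box ; (suc (suc (suc zero))) → rhd
     ; (suc (suc (suc (suc zero)))) → x ; (suc (suc (suc (suc (suc zero))))) → tick })
  (λ { zero → refl ; (suc zero) → refl ; (suc (suc zero)) → refl ; (suc (suc (suc zero))) → refl
     ; (suc (suc (suc (suc zero)))) → refl ; (suc (suc (suc (suc (suc zero))))) → refl })
  (λ { bot → refl ; imp → refl ; box → refl ; rhd → refl ; x → refl ; tick → refl })

-- In the reduction `outer` runs over levels and `inner` over tape cells. Outside the double loop
-- over `body`, `outer` stays at its final value m.
data Counter : Set where
  outer inner none : Counter

infixr 20 _⇒ᵀ_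
infix  40 □ᵀ_

-- The variable `var c o κ` is the one of kind κ at position o + (value of c).
data Template (Kind : Set) : Set where
  var  : Counter → ℕ → Kind → Template Kind
  ⊥ᵀ   : Template Kind
  _⇒ᵀ_ : Template Kind → Template Kind → Template Kind
  □ᵀ_  : Template Kind → Template Kind

env : ℕ → ℕ → Counter → ℕ
env j i outer = j
env j i inner = i
env j i none  = 0

gather : ∀ {B : Set} → ℕ → ℕ → (ℕ → List B) → List B
gather i zero    f = []
gather i (suc m) f = f i ++ gather (suc i) m f

premises : List Formula → List Symbol
premises []       = []
premises (A ∷ As) = imp ∷ encode A ++ premises As

premises-++ : ∀ As Bs → premises (As ++ Bs) ≡ premises As ++ premises Bs
premises-++ []       Bs = refl
premises-++ (A ∷ As) Bs = cong (imp ∷_) (trans (cong (encode A ++_) (premises-++ As Bs))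
                                                (sym (List.++-assoc (encode A) _ _)))

encode-foldr : ∀ As B → encode (foldr _⇒_ B As) ≡ premises As ++ encode B
encode-foldr []       B = refl
encode-foldr (A ∷ As) B = cong (imp ∷_) (trans (cong (encode A ++_) (encode-foldr As B))
                                                (sym (List.++-assoc (encode A) _ _)))

encode-□^⊥ : ∀ i → encode (□^⊥ i) ≡ replicate i box ++ bot ∷ []
encode-□^⊥ zero    = refl
encode-□^⊥ (suc i) = cong (box ∷_) (encode-□^⊥ i)

replicate-+ : ∀ {B : Set} m n (b : B) → replicate (m + n) b ≡ replicate m b ++ replicate n b
replicate-+ zero    n b = refl
replicate-+ (suc m) n b = cong (b ∷_) (replicate-+ m n b)

module Instances (Kind : Set) (code : Kind → ℕ) (K# : ℕ) where

  ν : ℕ → Kind → Formula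
  ν j κ = atom (code κ + j * K#)

  inst : (Counter → ℕ) → Template Kind → Formula
  inst e (var c o κ) = ν (o + e c) κ
  inst e ⊥ᵀ          = ⊥ᶠ
  inst e (S ⇒ᵀ T)    = inst e S ⇒ inst e T
  inst e (□ᵀ T)      = □ (inst e T)

  insts : (Counter → ℕ) → List (Template Kind) → List Formula
  insts e = map (inst e)

module Generator
  (A : Set) (A-fin : Finite A)
  (Kind : Set) (code : Kind → ℕ) (K# : ℕ)
  (size : Polynomial)
  (body boundary opening sides blanks : List (Template Kind))
  (symbol : A → List (Template Kind))
  where

  open Instances Kind code K#

  symbols : ℕ → ℕ → List A → List Formula
  symbols m i []      = []
  symbols m i (a ∷ w) = insts (env m i) (symbol a) ++ symbols m (suc i) w

  clauses : ℕ → List Formula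
  clauses m = gather 0 m (λ j → gather 0 (suc m) (λ i → insts (env j i) body)) ++ insts (env m 0) boundary

  -- The blank cells start at the end of the input and cover `suc m` positions. They go beyond m,
  -- but no difference has to be computed and nothing is assumed about the order of m and the input
  -- length.
  hypotheses : ℕ → List A → List Formula
  hypotheses m w =
    insts (env m 0) opening ++ gather 0 (suc m) (λ i → insts (env m i) sides) ++
    symbols m 0 w ++ gather (length w) (suc m) (λ i → insts (env m i) blanks)

  -- The hypotheses stand under one more box, so they are tested strictly below the world of the
  -- clauses. Clauses that are themselves boxed are then available both at that lower world and
  -- everywhere beneath it.
  formula : List A → Formula
  formula w = foldr _⇒_ (□ (foldr _⇒_ ⊥ᶠ (hypotheses m w))) (clauses m)
    where m = ⟦ size ⟧ (length w)

  X : Set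
  X = A ⊎ Symbol

  open StackPrograms X (finite-⊎ A-fin finite-Symbol) 8

  -- A loop consumes the stack it runs over, so each counter is a pair: the marks still to be
  -- visited and the marks done, whose number is the current value. `empty` lets `none` be treated
  -- as a counter with value 0.
  inp inp₂ jLeft iLeft jDone iDone empty scratch output : Fin 9
  inp     = # 0
  inp₂    = # 1
  jLeft   = # 2
  iLeft   = # 3
  jDone   = # 4
  iDone   = # 5
  empty   = # 6
  scratch = # 7
  output  = # 8

  • : X
  • = inj₂ tick

  marks : ℕ → List X
  marks m = replicate m •

  infixl 5 _⊳_

  _⊳_ : List X → List Symbol → List X
  o ⊳ w = map inj₂ w ʳ++ o

  ⊳-++ : ∀ o u v → o ⊳ u ⊳ v ≡ o ⊳ (u ++ v)
  ⊳-++ o u v = sym (trans (cong (_ʳ++ o) (List.map-++ inj₂ u v)) (List.++-ʳ++ (map inj₂ u)))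

  write : List Symbol → Prog
  write []      = skip
  write (s ∷ w) = push output (inj₂ s) ⨾ write w

  run-write : ∀ {a b c d e f g h o} w →
              Runs (write w) (a ∷ b ∷ c ∷ d ∷ e ∷ f ∷ g ∷ h ∷ o ∷ []) (suc (length w))
                             (a ∷ b ∷ c ∷ d ∷ e ∷ f ∷ g ∷ h ∷ (o ⊳ w) ∷ [])
  run-write []      = run-skip
  run-write (s ∷ w) = run-⨾ (run-push output (inj₂ s)) (run-write w)

  counter : Counter → Fin 9
  counter outer = jDone
  counter inner = iDone
  counter none  = empty

  -- All stacks with m marks in place of the chosen counter, because `transfer` empties that counter
  -- and refills it. This gives the three counters a common statement.
  slot : List X → List X → ℕ → ℕ → ℕ → ℕ → Counter → ℕ → ℕ → List X → Stacks
  slot xs ys u v j i outer m n o = xs ∷ ys ∷ marks u ∷ marks v ∷ marks m ∷ marks i ∷ [] ∷ marks n ∷ o ∷ []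
  slot xs ys u v j i inner m n o = xs ∷ ys ∷ marks u ∷ marks v ∷ marks j ∷ marks m ∷ [] ∷ marks n ∷ o ∷ []
  slot xs ys u v j i none  m n o = xs ∷ ys ∷ marks u ∷ marks v ∷ marks j ∷ marks i ∷ marks m ∷ marks n ∷ o ∷ []

  state : List X → List X → ℕ → ℕ → ℕ → ℕ → List X → Stacks
  state xs ys u v j i o = xs ∷ ys ∷ marks u ∷ marks v ∷ marks j ∷ marks i ∷ [] ∷ [] ∷ o ∷ []

  boxes : ℕ → List Symbol
  boxes n = replicate n box

  -- Printing a fixed number of boxes per mark multiplies the counter by `K#`, the distance between
  -- the indices of neighbouring positions.
  transfer : Fin 9 → Fin 9 → Prog
  transfer s t = while s (λ z → push t z ⨾ write (boxes K#))

  -- An atom contains two blocks of boxes that both depend on the counter. Moving the marks to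
  -- `scratch` prints the varying part of the first block, moving them back prints that of the
  -- second and restores the counter.
  emit : Template Kind → Prog
  emit (var c o κ) =
    write (imp ∷ rhd ∷ imp ∷ boxes r) ⨾ transfer (counter c) scratch ⨾
    write (bot ∷ bot ∷ imp ∷ box ∷ boxes r) ⨾ transfer scratch (counter c) ⨾
    write (bot ∷ bot ∷ bot ∷ [])
    where r = code κ + o * K#
  emit ⊥ᵀ       = write (bot ∷ [])
  emit (S ⇒ᵀ T) = push output (inj₂ imp) ⨾ emit S ⨾ emit T
  emit (□ᵀ T)   = push output (inj₂ box) ⨾ emit T

  lap : ℕ
  lap = 2 + (1 + suc K#)

  lap-cost : ∀ m → 2 + (1 + suc (length (boxes K#)) + (m * lap + 2)) ≡ suc m * lap + 2
  lap-cost m rewrite List.length-replicate K# {box} = lemma m K#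
    where
    lemma : ∀ m k → 2 + (1 + suc k + (m * (2 + (1 + suc k)) + 2)) ≡ suc m * (2 + (1 + suc k)) + 2
    lemma = solve-∀

  ⊳-boxes : ∀ o m → o ⊳ boxes K# ⊳ boxes (m * K#) ≡ o ⊳ boxes (suc m * K#)
  ⊳-boxes o m = trans (⊳-++ o (boxes K#) (boxes (m * K#))) (cong (o ⊳_) (sym (replicate-+ K# (m * K#) box)))

  module _ {xs ys : List X} {u v j i : ℕ} where

    slot′ : Counter → ℕ → ℕ → List X → Stacks
    slot′ = slot xs ys u v j i

    run-out : ∀ c {m n o} → Runs (transfer (counter c) scratch) (slot′ c m n o) (m * lap + 2)
                               (slot′ c 0 (m + n) (o ⊳ boxes (m * K#)))
    run-out outer {zero} = run-while-[] refl
    run-out inner {zero} = run-while-[] refl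
    run-out none  {zero} = run-while-[] refl
    run-out c {suc m} {n} {o} = subst₂ (Runs (transfer (counter c) scratch) (slot′ c (suc m) n o)) (lap-cost m)
      (cong₂ (slot′ c 0) (+-suc m n) (⊳-boxes o m)) (loop c)
      where
      loop : ∀ c → Runs (transfer (counter c) scratch) (slot′ c (suc m) n o) _
               (slot′ c 0 (m + suc n) (o ⊳ boxes K# ⊳ boxes (m * K#)))
      loop outer = run-while-∷ refl (run-⨾ (run-push scratch •) (run-write (boxes K#))) (run-out outer)
      loop inner = run-while-∷ refl (run-⨾ (run-push scratch •) (run-write (boxes K#))) (run-out inner)
      loop none  = run-while-∷ refl (run-⨾ (run-push scratch •) (run-write (boxes K#))) (run-out none)

    run-back : ∀ c {m n o} → Runs (transfer scratch (counter c)) (slot′ c m n o) (n * lap + 2)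
                                (slot′ c (n + m) 0 (o ⊳ boxes (n * K#)))
    run-back outer {n = zero} = run-while-[] refl
    run-back inner {n = zero} = run-while-[] refl
    run-back none  {n = zero} = run-while-[] refl
    run-back c {m} {suc n} {o} = subst₂ (Runs (transfer scratch (counter c)) (slot′ c m (suc n) o)) (lap-cost n)
      (cong₂ (λ l → slot′ c l 0) (+-suc n m) (⊳-boxes o n)) (loop c)
      where
      loop : ∀ c → Runs (transfer scratch (counter c)) (slot′ c m (suc n) o) _
               (slot′ c (n + suc m) 0 (o ⊳ boxes K# ⊳ boxes (n * K#)))
      loop outer = run-while-∷ refl (run-⨾ (run-push jDone •) (run-write (boxes K#))) (run-back outer)
      loop inner = run-while-∷ refl (run-⨾ (run-push iDone •) (run-write (boxes K#))) (run-back inner)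
      loop none  = run-while-∷ refl (run-⨾ (run-push empty •) (run-write (boxes K#))) (run-back none)

    run-write-slot : ∀ c {m n o} w → Runs (write w) (slot′ c m n o) (suc (length w)) (slot′ c m n (o ⊳ w))
    run-write-slot outer = run-write
    run-write-slot inner = run-write
    run-write-slot none  = run-write

  encode-atom : ∀ r n → encode (atom (r + n)) ≡
    (imp ∷ rhd ∷ imp ∷ boxes r) ++ boxes n ++ (bot ∷ bot ∷ imp ∷ box ∷ boxes r) ++ boxes n ++ bot ∷ bot ∷ bot ∷ []
  encode-atom r n rewrite encode-□^⊥ (r + n) | replicate-+ r n box = cong (λ w → imp ∷ rhd ∷ imp ∷ w) (begin
    (((P ++ bot ∷ []) ++ bot ∷ []) ++ imp ∷ box ∷ (P ++ bot ∷ []) ++ bot ∷ []) ++ bot ∷ []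
      ≡⟨ flatten P ⟩
    P ++ bot ∷ bot ∷ imp ∷ box ∷ P ++ bot ∷ bot ∷ bot ∷ []
      ≡⟨ List.++-assoc (boxes r) (boxes n) _ ⟩
    boxes r ++ boxes n ++ bot ∷ bot ∷ imp ∷ box ∷ P ++ bot ∷ bot ∷ bot ∷ []
      ≡⟨ cong (λ w → boxes r ++ boxes n ++ bot ∷ bot ∷ imp ∷ box ∷ w) (List.++-assoc (boxes r) (boxes n) _) ⟩
    boxes r ++ boxes n ++ bot ∷ bot ∷ imp ∷ box ∷ boxes r ++ boxes n ++ bot ∷ bot ∷ bot ∷ [] ∎)
    where
    open ≡-Reasoning
    P = boxes r ++ boxes n
    flatten : ∀ P → (((P ++ bot ∷ []) ++ bot ∷ []) ++ imp ∷ box ∷ (P ++ bot ∷ []) ++ bot ∷ []) ++ bot ∷ []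
                    ≡ P ++ bot ∷ bot ∷ imp ∷ box ∷ P ++ bot ∷ bot ∷ bot ∷ []
    flatten P rewrite List.++-assoc P (bot ∷ []) (bot ∷ [])
                    | List.++-assoc P (bot ∷ bot ∷ []) (imp ∷ box ∷ P ++ bot ∷ bot ∷ [])
                    | List.++-assoc P (bot ∷ bot ∷ imp ∷ box ∷ P ++ bot ∷ bot ∷ []) (bot ∷ [])
                    | List.++-assoc P (bot ∷ bot ∷ []) (bot ∷ []) = refl

  ⊳-atom : ∀ o r n →
    o ⊳ (imp ∷ rhd ∷ imp ∷ boxes r) ⊳ boxes n ⊳ (bot ∷ bot ∷ imp ∷ box ∷ boxes r) ⊳ boxes n ⊳ (bot ∷ bot ∷ bot ∷ [])
    ≡ o ⊳ encode (atom (r + n))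
  ⊳-atom o r n
    rewrite ⊳-++ (o ⊳ (imp ∷ rhd ∷ imp ∷ boxes r) ⊳ boxes n ⊳ (bot ∷ bot ∷ imp ∷ box ∷ boxes r)) (boxes n) (bot ∷ bot ∷ bot ∷ [])
          | ⊳-++ (o ⊳ (imp ∷ rhd ∷ imp ∷ boxes r) ⊳ boxes n) (bot ∷ bot ∷ imp ∷ box ∷ boxes r) (boxes n ++ bot ∷ bot ∷ bot ∷ [])
          | ⊳-++ (o ⊳ (imp ∷ rhd ∷ imp ∷ boxes r)) (boxes n) ((bot ∷ bot ∷ imp ∷ box ∷ boxes r) ++ boxes n ++ bot ∷ bot ∷ bot ∷ [])
          | ⊳-++ o (imp ∷ rhd ∷ imp ∷ boxes r) (boxes n ++ (bot ∷ bot ∷ imp ∷ box ∷ boxes r) ++ boxes n ++ bot ∷ bot ∷ bot ∷ [])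
    = cong (o ⊳_) (sym (encode-atom r n))

  -- Multiplied by `suc B`, it bounds the printing time while both counters are at most B; with a
  -- common factor the costs of subtemplates simply add up. The constant 17 collects the fixed
  -- symbols and the loop exits of one atom.
  weight : Template Kind → ℕ
  weight (var c o κ) = 17 + 2 * (code κ + o * K#) + 2 * lap
  weight ⊥ᵀ          = 2
  weight (S ⇒ᵀ T)    = 1 + (weight S + weight T)
  weight (□ᵀ T)      = 1 + weight T

  var-cost : ∀ r {m B} → m ≤ B →
    4 + length (boxes r) + (m * lap + 2 + (5 + length (boxes r) + ((m + 0) * lap + 2 + 4)))
    ≤ (17 + 2 * r + 2 * lap) * suc B
  var-cost r {m} {B} m≤B rewrite List.length-replicate r {box} | +-identityʳ m = begin
    4 + r + (m * lap + 2 + (5 + r + (m * lap + 2 + 4)))  ≡⟨ lhs r (m * lap) ⟩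
    17 + 2 * r + 2 * (m * lap)                           ≤⟨ +-monoʳ-≤ (17 + 2 * r) (*-monoʳ-≤ 2 (*-monoˡ-≤ lap m≤B)) ⟩
    17 + 2 * r + 2 * (B * lap)                           ≤⟨ m≤m+n _ (2 * lap + 17 * B + 2 * r * B) ⟩
    17 + 2 * r + 2 * (B * lap) + (2 * lap + 17 * B + 2 * r * B) ≡⟨ rhs r B lap ⟩
    (17 + 2 * r + 2 * lap) * suc B                       ∎
    where
    open ≤-Reasoning
    lhs : ∀ r n → 4 + r + (n + 2 + (5 + r + (n + 2 + 4))) ≡ 17 + 2 * r + 2 * n
    lhs = solve-∀
    rhs : ∀ r B l → 17 + 2 * r + 2 * (B * l) + (2 * l + 17 * B + 2 * r * B) ≡ (17 + 2 * r + 2 * l) * (1 + B)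
    rhs = solve-∀

  one≤ : ∀ {m n B} → m ≤ n * suc B → 1 + m ≤ suc n * suc B
  one≤ m≤ = s≤s (≤-trans m≤ (m≤n+m _ _))

  both≤ : ∀ m n {B} → m * suc B + n * suc B ≤ (m + n) * suc B
  both≤ m n {B} = ≤-reflexive (sym (*-distribʳ-+ (suc B) m n))

  module _ {xs ys : List X} {u v : ℕ} (j i : ℕ) {B : ℕ} (j≤B : j ≤ B) (i≤B : i ≤ B) where

    st : List X → Stacks
    st = state xs ys u v j i

    env≤B : ∀ c → env j i c ≤ B
    env≤B outer = j≤B
    env≤B inner = i≤B
    env≤B none  = z≤n

    slot≡st : ∀ c o → slot xs ys u v j i c (env j i c) 0 o ≡ st o
    slot≡st outer o = refl
    slot≡st inner o = refl
    slot≡st none  o = refl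

    run-emit : ∀ T {o} → Runs (emit T) (st o) (weight T * suc B) (st (o ⊳ encode (inst (env j i) T)))
    run-emit (var c s κ) {o} =
      weaken (var-cost r (env≤B c)) (subst₂ (λ a b → Runs (emit (var c s κ)) a _ b)
        (slot≡st c o) (trans (cong₂ (λ m w → slot xs ys u v j i c m 0 w) restored out) (slot≡st c _))
        (run-⨾ (run-write-slot c _) (run-⨾ (run-out c) (run-⨾ (run-write-slot c _) (run-⨾ (run-back c) (run-write-slot c _))))))
      where
      r = code κ + s * K#
      m = env j i c
      restored : m + 0 + 0 ≡ m
      restored = trans (+-identityʳ _) (+-identityʳ m)
      index : r + m * K# ≡ code κ + (s + m) * K#
      index = lemma (code κ) s m K#
        where
        lemma : ∀ a s m k → a + s * k + m * k ≡ a + (s + m) * k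
        lemma = solve-∀
      out : o ⊳ (imp ∷ rhd ∷ imp ∷ boxes r) ⊳ boxes (m * K#) ⊳ (bot ∷ bot ∷ imp ∷ box ∷ boxes r) ⊳ boxes ((m + 0) * K#)
              ⊳ (bot ∷ bot ∷ bot ∷ []) ≡ o ⊳ encode (ν (s + m) κ)
      out rewrite +-identityʳ m = trans (⊳-atom o r (m * K#)) (cong (λ n → o ⊳ encode (atom n)) index)
    run-emit ⊥ᵀ       = weaken (m≤m*n 2 (suc B)) (run-write (bot ∷ []))
    run-emit (S ⇒ᵀ T) {o} = weaken (one≤ {n = weight S + weight T} (both≤ (weight S) (weight T)))
      (subst (Runs (emit (S ⇒ᵀ T)) (st o) _) (cong st (⊳-++ _ (encode (inst (env j i) S)) _))
        (run-⨾ (run-push output (inj₂ imp)) (run-⨾ (run-emit S) (run-emit T))))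
    run-emit (□ᵀ T)   = weaken (one≤ {n = weight T} ≤-refl) (run-⨾ (run-push output (inj₂ box)) (run-emit T))

  -- Printing lists of premises and looping over the counters

  emits : List (Template Kind) → Prog
  emits []       = skip
  emits (T ∷ Ts) = push output (inj₂ imp) ⨾ emit T ⨾ emits Ts

  weights : List (Template Kind) → ℕ
  weights []       = 1
  weights (T ∷ Ts) = 1 + (weight T + weights Ts)

  ⊳-premises : ∀ o As Bs → o ⊳ premises As ⊳ premises Bs ≡ o ⊳ premises (As ++ Bs)
  ⊳-premises o As Bs = trans (⊳-++ o (premises As) (premises Bs)) (cong (o ⊳_) (sym (premises-++ As Bs)))

  run-emits : ∀ Ts {xs ys u v j i B o} → j ≤ B → i ≤ B →
              Runs (emits Ts) (state xs ys u v j i o) (weights Ts * suc B)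
                              (state xs ys u v j i (o ⊳ premises (insts (env j i) Ts)))
  run-emits []       {B = B} j≤B i≤B = weaken (m≤m*n 1 (suc B)) run-skip
  run-emits (T ∷ Ts) {xs} {ys} {u} {v} {j} {i} {o = o} j≤B i≤B =
    weaken (one≤ {n = weight T + weights Ts} (both≤ (weight T) (weights Ts)))
      (subst (Runs (emits (T ∷ Ts)) _ _) (cong (state xs ys u v j i) (⊳-++ _ (encode (inst (env j i) T)) _))
        (run-⨾ (run-push output (inj₂ imp)) (run-⨾ (run-emit j i j≤B i≤B T) (run-emits Ts j≤B i≤B))))

  tally : List (Template Kind) → Prog
  tally Ts = while iLeft (λ z → emits Ts ⨾ push iDone z)

  tally-cost : ℕ → ℕ → List (Template Kind) → ℕ
  tally-cost B v Ts = v * (2 + (weights Ts * suc B + 1)) + 2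

  lap≡ : ∀ n c → 2 + (c + (n * (2 + c) + 2)) ≡ suc n * (2 + c) + 2
  lap≡ n c = lemma n c
    where
    lemma : ∀ n c → 2 + (c + (n * (2 + c) + 2)) ≡ (1 + n) * (2 + c) + 2
    lemma = solve-∀

  run-tally : ∀ Ts v {xs ys u j i B o} → j ≤ B → v + i ≤ B →
              Runs (tally Ts) (state xs ys u v j i o) (tally-cost B v Ts)
                (state xs ys u 0 j (v + i) (o ⊳ premises (gather i v (λ i → insts (env j i) Ts))))
  run-tally Ts zero    j≤B i≤B = run-while-[] refl
  run-tally Ts (suc v) {xs} {ys} {u} {j} {i} {B} {o} j≤B i≤B =
    subst₂ (Runs (tally Ts) _) (lap≡ v (weights Ts * suc B + 1))
      (cong₂ (state xs ys u 0 j) (+-suc v i) (⊳-premises o (insts (env j i) Ts) _))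
      (run-while-∷ refl (run-⨾ (run-emits Ts j≤B (m+n≤o⇒n≤o (suc v) i≤B)) (run-push iDone •))
        (run-tally Ts v j≤B (subst (_≤ B) (sym (+-suc v i)) i≤B)))

  move-all : Fin 9 → Fin 9 → Prog
  move-all s t = while s (push t)

  run-rewind : ∀ i {xs ys u v j o} → Runs (move-all iDone iLeft) (state xs ys u v j i o) (i * 3 + 2)
                                          (state xs ys u (i + v) j 0 o)
  run-rewind zero    = run-while-[] refl
  run-rewind (suc i) {xs} {ys} {u} {v} {j} {o} =
    subst (Runs _ _ _) (cong (λ v → state xs ys u v j 0 o) (+-suc i v))
      (run-while-∷ refl (run-push iLeft •) (run-rewind i))

  run-tally-rewind : ∀ Ts v {xs ys u j B o} → j ≤ B → v ≤ B →
    Runs (tally Ts ⨾ move-all iDone iLeft) (state xs ys u v j 0 o) (tally-cost B v Ts + (v * 3 + 2))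
      (state xs ys u v j 0 (o ⊳ premises (gather 0 v (λ i → insts (env j i) Ts))))
  run-tally-rewind Ts v {xs} {ys} {u} {j} {B} {o} j≤B v≤B =
    run-⨾ (subst (Runs _ _ _) (cong (λ i → state xs ys u 0 j i o′) (+-identityʳ v))
             (run-tally Ts v j≤B (subst (_≤ B) (sym (+-identityʳ v)) v≤B)))
          (subst (Runs _ _ _) (cong (λ v → state xs ys u v j 0 o′) (+-identityʳ v)) (run-rewind v))
    where o′ = o ⊳ premises (gather 0 v (λ i → insts (env j i) Ts))

  grid : Prog
  grid = while jLeft (λ z → (tally body ⨾ move-all iDone iLeft) ⨾ push jDone z)

  grid-cost : ℕ → ℕ → ℕ → ℕ
  grid-cost B u v = u * (2 + (tally-cost B v body + (v * 3 + 2) + 1)) + 2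

  run-grid : ∀ u {xs ys v j B o} → u + j ≤ B → v ≤ B →
             Runs grid (state xs ys u v j 0 o) (grid-cost B u v)
               (state xs ys 0 v (u + j) 0
                 (o ⊳ premises (gather j u (λ j → gather 0 v (λ i → insts (env j i) body)))))
  run-grid zero    j≤B v≤B = run-while-[] refl
  run-grid (suc u) {xs} {ys} {v} {j} {B} {o} j≤B v≤B =
    subst₂ (Runs grid _) (lap≡ u (tally-cost B v body + (v * 3 + 2) + 1))
      (cong₂ (λ j → state xs ys 0 v j 0) (+-suc u j) (⊳-premises o (gather 0 v (λ i → insts (env j i) body)) _))
      (run-while-∷ refl (run-⨾ (run-tally-rewind body v (m+n≤o⇒n≤o (suc u) j≤B) v≤B) (run-push jDone •))
        (run-grid u (subst (_≤ B) (sym (+-suc u j)) j≤B) v≤B))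

  run-inp : ∀ xs {ys u v j i o} → Runs (move-all inp inp₂) (state xs ys u v j i o) (length xs * 3 + 2)
                                       (state [] (xs ʳ++ ys) u v j i o)
  run-inp []       = run-while-[] refl
  run-inp (z ∷ xs) = run-while-∷ refl (run-push inp₂ z) (run-inp xs)

  run-inp₂ : ∀ ys {xs u v j i o} → Runs (move-all inp₂ inp) (state xs ys u v j i o) (length ys * 3 + 2)
                                        (state (ys ʳ++ xs) [] u v j i o)
  run-inp₂ []       = run-while-[] refl
  run-inp₂ (z ∷ ys) = run-while-∷ refl (run-push inp z) (run-inp₂ ys)

  -- It runs after the input has been moved to `inp₂`, which brings the first letter to the top. The
  -- mark left on `iDone` for each letter makes `inner` the position of the letter, and the blanks
  -- printed afterwards continue from there.
  scan : Prog
  scan = while inp₂ λ { (inj₁ a) → emits (symbol a) ⨾ push iDone • ; (inj₂ _) → skip }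

  ∈⇒≤sum : ∀ {B : Set} (f : B → ℕ) {b bs} → b ∈ bs → f b ≤ sum (map f bs)
  ∈⇒≤sum f (here refl) = m≤m+n _ _
  ∈⇒≤sum f (there b∈)  = ≤-trans (∈⇒≤sum f b∈) (m≤n+m _ _)

  -- Letters may differ in cost; the sum over the finite alphabet is a bound independent of the
  -- letter.
  symbol-weight : ℕ
  symbol-weight = sum (map (weights ∘ symbol) (enum A-fin))

  scan-cost : ℕ → ℕ → ℕ
  scan-cost B n = n * (2 + (symbol-weight * suc B + 1)) + 2

  run-scan : ∀ w {xs u v j i B o} → j ≤ B → length w + i ≤ B →
             Runs scan (state xs (map inj₁ w) u v j i o) (scan-cost B (length w))
               (state xs [] u v j (length w + i) (o ⊳ premises (symbols j i w)))
  run-scan []      j≤B i≤B = run-while-[] refl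
  run-scan (a ∷ w) {xs} {u} {v} {j} {i} {B} {o} j≤B i≤B =
    subst₂ (Runs scan _) (lap≡ (length w) (symbol-weight * suc B + 1))
      (cong₂ (state xs [] u v j) (+-suc (length w) i) (⊳-premises o (insts (env j i) (symbol a)) _))
      (run-while-∷ refl
        (run-⨾ (weaken (*-monoˡ-≤ (suc B) (∈⇒≤sum (weights ∘ symbol) (∈-enum A-fin a)))
                 (run-emits (symbol a) j≤B (m+n≤o⇒n≤o (suc (length w)) i≤B)))
               (run-push iDone •))
        (run-scan w j≤B (subst (_≤ B) (sym (+-suc (length w) i)) i≤B)))

  pushes : ℕ → Prog
  pushes zero    = skip
  pushes (suc n) = push iLeft • ⨾ pushes n

  run-pushes : ∀ n {xs ys u v j i o} → Runs (pushes n) (state xs ys u v j i o) (suc n) (state xs ys u (n + v) j i o)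
  run-pushes zero    = run-skip
  run-pushes (suc n) {xs} {ys} {u} {v} {j} {i} {o} =
    subst (Runs _ _ _) (cong (λ v → state xs ys u v j i o) (+-suc n v)) (run-⨾ (run-push iLeft •) (run-pushes n))

  run-iLeft→jLeft : ∀ v {xs ys u j i o} → Runs (move-all iLeft jLeft) (state xs ys u v j i o) (v * 3 + 2)
                                                (state xs ys (v + u) 0 j i o)
  run-iLeft→jLeft zero    = run-while-[] refl
  run-iLeft→jLeft (suc v) {xs} {ys} {u} {j} {i} {o} =
    subst (Runs _ _ _) (cong (λ u → state xs ys u 0 j i o) (+-suc v u))
      (run-while-∷ refl (run-push jLeft •) (run-iLeft→jLeft v))

  add-length : Prog
  add-length = while inp (λ z → push iLeft • ⨾ push inp₂ z) ⨾ move-all inp₂ inp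

  run-count : ∀ xs {ys u v j i o} →
              Runs (while inp (λ z → push iLeft • ⨾ push inp₂ z)) (state xs ys u v j i o) (length xs * 4 + 2)
                   (state [] (xs ʳ++ ys) u (length xs + v) j i o)
  run-count []       = run-while-[] refl
  run-count (z ∷ xs) {ys} {u} {v} {j} {i} {o} =
    subst (Runs _ _ _) (cong (λ v → state [] (xs ʳ++ z ∷ ys) u v j i o) (+-suc (length xs) v))
      (run-while-∷ refl (run-⨾ (run-push iLeft •) (run-push inp₂ z)) (run-count xs))

  run-add-length : ∀ xs {u v j i o} →
                   Runs add-length (state xs [] u v j i o) (length xs * 4 + 2 + (length xs * 3 + 2))
                                   (state xs [] u (length xs + v) j i o)
  run-add-length xs {u} {v} {j} {i} {o} = run-⨾ (run-count xs)
    (subst₂ (Runs _ _) (cong (λ n → n * 3 + 2) (List.length-reverse xs))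
      (cong (λ ys → state ys [] u (length xs + v) j i o) (trans (List.ʳ++-ʳ++ xs) (List.++-identityʳ xs)))
      (run-inp₂ (xs ʳ++ [])))

  -- Horner's scheme: from ⟦ p ⟧ n marks on jLeft to a + n * ⟦ p ⟧ n of them.
  horner : Polynomial → Prog
  horner []      = skip
  horner (a ∷ p) = horner p ⨾ while jLeft (λ _ → add-length) ⨾ pushes a ⨾ move-all iLeft jLeft

  horner-cost : Polynomial → ℕ → ℕ
  horner-cost []      n = 1
  horner-cost (a ∷ p) n =
    horner-cost p n + (⟦ p ⟧ n * (2 + (n * 4 + 2 + (n * 3 + 2))) + 2 + (suc a + (⟦ a ∷ p ⟧ n * 3 + 2)))

  run-multiply : ∀ u xs {v j i o} →
                 Runs (while jLeft (λ _ → add-length)) (state xs [] u v j i o)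
                      (u * (2 + (length xs * 4 + 2 + (length xs * 3 + 2))) + 2)
                      (state xs [] 0 (length xs * u + v) j i o)
  run-multiply zero    xs {v} {j} {i} {o} =
    subst (Runs _ _ _) (cong (λ m → state xs [] 0 (m + v) j i o) (sym (*-zeroʳ (length xs)))) (run-while-[] refl)
  run-multiply (suc u) xs {v} {j} {i} {o} =
    subst₂ (Runs _ _) (lap≡ u (length xs * 4 + 2 + (length xs * 3 + 2)))
      (cong (λ v → state xs [] 0 v j i o) (lemma (length xs) u v))
      (run-while-∷ refl (run-add-length xs) (run-multiply u xs))
    where
    lemma : ∀ n u v → n * u + (n + v) ≡ n * (1 + u) + v
    lemma = solve-∀

  run-horner : ∀ p xs {j i o} → Runs (horner p) (state xs [] 0 0 j i o) (horner-cost p (length xs))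
                                     (state xs [] (⟦ p ⟧ (length xs)) 0 j i o)
  run-horner []      xs = run-skip
  run-horner (a ∷ p) xs {j} {i} {o} =
    run-⨾ (run-horner p xs) (run-⨾ (run-multiply (⟦ p ⟧ n) xs) (run-⨾ (run-pushes a)
      (subst₂ (λ v u → Runs (move-all iLeft jLeft) (state xs [] 0 v j i o) (⟦ a ∷ p ⟧ n * 3 + 2) (state xs [] u 0 j i o))
        (cong (a +_) (sym (+-identityʳ _))) (+-identityʳ _)
        (run-iLeft→jLeft (⟦ a ∷ p ⟧ n)))))
    where n = length xs

  share : Prog
  share = while jLeft (λ z → push jDone z ⨾ push iLeft z)

  run-share : ∀ u {xs ys v j i o} → Runs share (state xs ys u v j i o) (u * 4 + 2)
                                         (state xs ys 0 (u + v) (u + j) i o)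
  run-share zero    = run-while-[] refl
  run-share (suc u) {xs} {ys} {v} {j} {i} {o} =
    subst (Runs _ _ _) (cong₂ (λ v j → state xs ys 0 v j i o) (+-suc u v) (+-suc u j))
      (run-while-∷ refl (run-⨾ (run-push jDone •) (run-push iLeft •)) (run-share u))

  run-jDone→jLeft : ∀ j {xs ys u v i o} → Runs (move-all jDone jLeft) (state xs ys u v j i o) (j * 3 + 2)
                                                (state xs ys (j + u) v 0 i o)
  run-jDone→jLeft zero    = run-while-[] refl
  run-jDone→jLeft (suc j) {xs} {ys} {u} {v} {i} {o} =
    subst (Runs _ _ _) (cong (λ u → state xs ys u v 0 i o) (+-suc j u))
      (run-while-∷ refl (run-push jLeft •) (run-jDone→jLeft j))

  -- This sets up the loop bounds. The additional mark on `iLeft` is there because cells run from 0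
  -- to m inclusive, whereas the levels handled by `outer` stay below m.
  duplicate : Prog
  duplicate = share ⨾ move-all jDone jLeft ⨾ push iLeft •

  run-duplicate : ∀ u {xs ys i o} →
                  Runs duplicate (state xs ys u 0 0 i o) (u * 4 + 2 + (u * 3 + 2 + 1)) (state xs ys u (suc u) 0 i o)
  run-duplicate u {xs} {ys} {i} {o} =
    run-⨾ (subst (Runs _ _ _) (cong (λ m → state xs ys 0 m m i o) (+-identityʳ u)) (run-share u))
      (run-⨾ (subst (Runs _ _ _) (cong (λ m → state xs ys m u 0 i o) (+-identityʳ u)) (run-jDone→jLeft u))
             (run-push iLeft •))

  -- The complete generator and its running time

  generate : Prog
  generate =
    horner size ⨾ duplicate ⨾ grid ⨾ emits boundary ⨾ write (box ∷ []) ⨾ emits opening ⨾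
    (tally sides ⨾ move-all iDone iLeft) ⨾ move-all inp inp₂ ⨾ scan ⨾ tally blanks ⨾ write (bot ∷ [])

  cost : ℕ → ℕ
  cost n =
    horner-cost size n + (m * 4 + 2 + (m * 3 + 2 + 1) + (grid-cost B m (suc m) + (weights boundary * suc B + (2 +
    (weights opening * suc B + (tally-cost B (suc m) sides + (suc m * 3 + 2) + (n * 3 + 2 + (scan-cost B n +
    (tally-cost B (suc m) blanks + 2)))))))))
    where
    m = ⟦ size ⟧ n
    B = n + suc m

  bounded-cost : PolyBounded cost
  bounded-cost =
    horner-bounded size ⊞ (m ⊠ c 4 ⊞ c 2 ⊞ (m ⊠ c 3 ⊞ c 2 ⊞ c 1) ⊞ (grid-bounded ⊞ (emits-bounded boundary ⊞ (c 2 ⊞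
    (emits-bounded opening ⊞ (tally-bounded sides ⊞ (m+1 ⊠ c 3 ⊞ c 2) ⊞ (n ⊠ c 3 ⊞ c 2 ⊞ (scan-bounded ⊞
    (tally-bounded blanks ⊞ c 2)))))))))
    where
    infixl 6 _⊞_
    infixl 7 _⊠_
    _⊞_ : ∀ {f g} → PolyBounded f → PolyBounded g → PolyBounded (λ n → f n + g n)
    _⊞_ {f} {g} = bounded-+ {f} {g}
    _⊠_ : ∀ {f g} → PolyBounded f → PolyBounded g → PolyBounded (λ n → f n * g n)
    _⊠_ {f} {g} = bounded-* {f} {g}
    c = bounded-const
    n = bounded-id
    m = bounded-⟦⟧ size
    m+1 : PolyBounded (λ n → suc (⟦ size ⟧ n))
    m+1 = c 1 ⊞ m
    B+1 : PolyBounded (λ n → suc (n + suc (⟦ size ⟧ n)))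
    B+1 = c 1 ⊞ (n ⊞ m+1)
    emits-bounded : ∀ Ts → PolyBounded (λ n → weights Ts * suc (n + suc (⟦ size ⟧ n)))
    emits-bounded Ts = c (weights Ts) ⊠ B+1
    tally-bounded : ∀ Ts → PolyBounded (λ n → tally-cost (n + suc (⟦ size ⟧ n)) (suc (⟦ size ⟧ n)) Ts)
    tally-bounded Ts = m+1 ⊠ (c 2 ⊞ (emits-bounded Ts ⊞ c 1)) ⊞ c 2
    grid-bounded : PolyBounded (λ n → grid-cost (n + suc (⟦ size ⟧ n)) (⟦ size ⟧ n) (suc (⟦ size ⟧ n)))
    grid-bounded = m ⊠ (c 2 ⊞ (tally-bounded body ⊞ (m+1 ⊠ c 3 ⊞ c 2) ⊞ c 1)) ⊞ c 2
    scan-bounded : PolyBounded (λ n → scan-cost (n + suc (⟦ size ⟧ n)) n)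
    scan-bounded = n ⊠ (c 2 ⊞ (c symbol-weight ⊠ B+1 ⊞ c 1)) ⊞ c 2
    horner-bounded : ∀ p → PolyBounded (horner-cost p)
    horner-bounded []      = c 1
    horner-bounded (a ∷ p) = horner-bounded p ⊞
      (bounded-⟦⟧ p ⊠ (c 2 ⊞ (n ⊠ c 4 ⊞ c 2 ⊞ (n ⊠ c 3 ⊞ c 2))) ⊞ c 2 ⊞ (c (suc a) ⊞ (bounded-⟦⟧ (a ∷ p) ⊠ c 3 ⊞ c 2)))

  ⊳-formula : ∀ w → let m = ⟦ size ⟧ (length w) in
    [] ⊳ premises (gather 0 m (λ j → gather 0 (suc m) (λ i → insts (env j i) body)))
       ⊳ premises (insts (env m 0) boundary) ⊳ (box ∷ [])
       ⊳ premises (insts (env m 0) opening)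
       ⊳ premises (gather 0 (suc m) (λ i → insts (env m i) sides))
       ⊳ premises (symbols m 0 w)
       ⊳ premises (gather (length w) (suc m) (λ i → insts (env m i) blanks)) ⊳ (bot ∷ [])
    ≡ [] ⊳ encode (formula w)
  ⊳-formula w = begin
    [] ⊳ premises c₁ ⊳ premises c₂ ⊳ (box ∷ []) ⊳ premises h₁ ⊳ premises h₂ ⊳ premises h₃ ⊳ premises h₄ ⊳ (bot ∷ [])
      ≡⟨ cong (_⊳ (bot ∷ [])) joined ⟩
    [] ⊳ premises (c₁ ++ c₂) ⊳ (box ∷ []) ⊳ premises (h₁ ++ h₂ ++ h₃ ++ h₄) ⊳ (bot ∷ [])
      ≡⟨ ⊳-++ ([] ⊳ premises (c₁ ++ c₂) ⊳ (box ∷ [])) (premises (h₁ ++ h₂ ++ h₃ ++ h₄)) (bot ∷ []) ⟩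
    [] ⊳ premises (c₁ ++ c₂) ⊳ (box ∷ []) ⊳ (premises (h₁ ++ h₂ ++ h₃ ++ h₄) ++ bot ∷ [])
      ≡⟨ cong ([] ⊳ premises (c₁ ++ c₂) ⊳ (box ∷ []) ⊳_) (sym (encode-foldr (h₁ ++ h₂ ++ h₃ ++ h₄) ⊥ᶠ)) ⟩
    [] ⊳ premises (c₁ ++ c₂) ⊳ (box ∷ encode (foldr _⇒_ ⊥ᶠ (h₁ ++ h₂ ++ h₃ ++ h₄)))
      ≡⟨ ⊳-++ [] (premises (c₁ ++ c₂)) _ ⟩
    [] ⊳ (premises (c₁ ++ c₂) ++ box ∷ encode (foldr _⇒_ ⊥ᶠ (h₁ ++ h₂ ++ h₃ ++ h₄)))
      ≡⟨ cong ([] ⊳_) (sym (encode-foldr (c₁ ++ c₂) _)) ⟩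
    [] ⊳ encode (formula w) ∎
    where
    open ≡-Reasoning
    m = ⟦ size ⟧ (length w)
    c₁ = gather 0 m (λ j → gather 0 (suc m) (λ i → insts (env j i) body))
    c₂ = insts (env m 0) boundary
    h₁ = insts (env m 0) opening
    h₂ = gather 0 (suc m) (λ i → insts (env m i) sides)
    h₃ = symbols m 0 w
    h₄ = gather (length w) (suc m) (λ i → insts (env m i) blanks)
    o = [] ⊳ premises (c₁ ++ c₂) ⊳ (box ∷ [])
    joined : [] ⊳ premises c₁ ⊳ premises c₂ ⊳ (box ∷ []) ⊳ premises h₁ ⊳ premises h₂ ⊳ premises h₃ ⊳ premises h₄
             ≡ o ⊳ premises (h₁ ++ h₂ ++ h₃ ++ h₄)
    joined = begin
      [] ⊳ premises c₁ ⊳ premises c₂ ⊳ (box ∷ []) ⊳ premises h₁ ⊳ premises h₂ ⊳ premises h₃ ⊳ premises h₄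
        ≡⟨ cong (λ o → o ⊳ (box ∷ []) ⊳ premises h₁ ⊳ premises h₂ ⊳ premises h₃ ⊳ premises h₄) (⊳-premises [] c₁ c₂) ⟩
      o ⊳ premises h₁ ⊳ premises h₂ ⊳ premises h₃ ⊳ premises h₄
        ≡⟨ ⊳-premises (o ⊳ premises h₁ ⊳ premises h₂) h₃ h₄ ⟩
      o ⊳ premises h₁ ⊳ premises h₂ ⊳ premises (h₃ ++ h₄)
        ≡⟨ ⊳-premises (o ⊳ premises h₁) h₂ (h₃ ++ h₄) ⟩
      o ⊳ premises h₁ ⊳ premises (h₂ ++ h₃ ++ h₄)
        ≡⟨ ⊳-premises o h₁ (h₂ ++ h₃ ++ h₄) ⟩
      o ⊳ premises (h₁ ++ h₂ ++ h₃ ++ h₄) ∎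

  run-generate : ∀ w → ∃[ i ] Runs generate (state (reverse (map inj₁ w)) [] 0 0 0 0 []) (cost (length w))
                               (state [] [] 0 0 (⟦ size ⟧ (length w)) i ([] ⊳ encode (formula w)))
  run-generate w = suc m + n ,
    subst (Runs _ _ _) (cong (state [] [] 0 0 m (suc m + n)) (⊳-formula w))
      (run-⨾ (subst (λ l → Runs (horner size) (state xs [] 0 0 0 0 []) (horner-cost size l) (state xs [] (⟦ size ⟧ l) 0 0 0 []))
               length-xs (run-horner size xs))
      (run-⨾ (run-duplicate m)
      (run-⨾ (subst (Runs _ _ _) (cong (λ j → state xs [] 0 (suc m) j 0 grid-out) (+-identityʳ m))
               (run-grid m {B = B} (subst (_≤ B) (sym (+-identityʳ m)) m≤B) (m≤n+m (suc m) n)))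
      (run-⨾ (run-emits boundary m≤B z≤n)
      (run-⨾ (run-write (box ∷ []))
      (run-⨾ (run-emits opening m≤B z≤n)
      (run-⨾ (run-tally-rewind sides (suc m) m≤B (m≤n+m (suc m) n))
      (run-⨾ (subst₂ (Runs _ _) (cong (λ l → l * 3 + 2) length-xs)
               (cong (λ ys → state [] ys 0 (suc m) m 0 sides-out) unreversed) (run-inp xs))
      (run-⨾ (subst (Runs _ _ _) (cong (λ i → state [] [] 0 (suc m) m i (sides-out ⊳ premises (symbols m 0 w))) (+-identityʳ n))
               (run-scan w {B = B} m≤B (subst (_≤ B) (sym (+-identityʳ n)) (m≤m+n n (suc m)))))
      (run-⨾ (run-tally blanks (suc m) m≤B (≤-reflexive (+-comm (suc m) n)))
             (run-write (bot ∷ []))))))))))))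
    where
    n = length w
    m = ⟦ size ⟧ n
    B = n + suc m
    xs = reverse (map inj₁ w)
    m≤B : m ≤ B
    m≤B = ≤-trans (n≤1+n m) (m≤n+m (suc m) n)
    length-xs : length xs ≡ n
    length-xs = trans (List.length-reverse (map inj₁ w)) (List.length-map inj₁ w)
    unreversed : xs ʳ++ [] ≡ map inj₁ w
    unreversed = List.reverse-involutive (map inj₁ w)
    grid-out = [] ⊳ premises (gather 0 m (λ j → gather 0 (suc m) (λ i → insts (env j i) body)))
    sides-out = grid-out ⊳ premises (insts (env m 0) boundary) ⊳ (box ∷ []) ⊳ premises (insts (env m 0) opening)
                  ⊳ premises (gather 0 (suc m) (λ i → insts (env m i) sides))

  formula-polyTime : PolyTime (encode ∘ formula)
  formula-polyTime = polyTime (mk↣ inj₁-injective) (mk↣ inj₂-injective) generate {cost} bounded-cost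
    λ w → _ , proj₂ (run-generate w) , refl

-- Computations

pattern behind = false
pattern ahead  = true

lookup-ext : ∀ {A : Set} {n} (xs ys : Vec A n) → (∀ i → lookup xs i ≡ lookup ys i) → xs ≡ ys
lookup-ext []       []       eq = refl
lookup-ext (_ ∷ xs) (_ ∷ ys) eq = cong₂ _∷_ (eq zero) (lookup-ext xs ys (eq ∘ suc))

-- The cell before a move whose symbol is in cell (d , j) after it; `nothing`
-- stands for the symbol just written.
source : Move → Bool → ℕ → Maybe (Bool × ℕ)
source stay  ahead  zero          = nothing
source stay  ahead  (suc j)       = just (ahead , suc j)
source stay  behind j             = just (behind , j)
source right ahead  j             = just (ahead , suc j)
source right behind zero          = nothing
source right behind (suc j)       = just (behind , j)
source left  ahead  zero          = just (behind , 0)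
source left  ahead  (suc zero)    = nothing
source left  ahead  (suc (suc j)) = just (ahead , suc j)
source left  behind j             = just (behind , suc j)

module Dynamics (M : Machine) where
  open Machine M

  nth : List Γ → ℕ → Γ
  nth []       _       = blank
  nth (a ∷ _)  zero    = a
  nth (_ ∷ as) (suc j) = nth as j

  nth-≥ : ∀ as {j} → length as ≤ j → nth as j ≡ blank
  nth-≥ []       _         = refl
  nth-≥ (_ ∷ as) (s≤s len) = nth-≥ as len

  -- Positions are relative to the head, which scans the cell (ahead , 0).
  cell : Tape Γ → Bool → ℕ → Γ
  cell (tape ls a rs) ahead  = nth (a ∷ rs)
  cell (tape ls a rs) behind = nth ls

  cell-act : ∀ b m t d j → cell (act (b , m) t) d j ≡ maybe′ (λ (d′ , j′) → cell t d′ j′) b (source m d j)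
  cell-act b stay  (tape _       _ _)       ahead  zero          = refl
  cell-act b stay  (tape _       _ _)       ahead  (suc j)       = refl
  cell-act b stay  (tape _       _ _)       behind j             = refl
  cell-act b right (tape _       _ [])      ahead  zero          = refl
  cell-act b right (tape _       _ [])      ahead  (suc j)       = refl
  cell-act b right (tape _       _ (_ ∷ _)) ahead  j             = refl
  cell-act b right (tape _       _ [])      behind zero          = refl
  cell-act b right (tape _       _ (_ ∷ _)) behind zero          = refl
  cell-act b right (tape _       _ [])      behind (suc j)       = refl
  cell-act b right (tape _       _ (_ ∷ _)) behind (suc j)       = refl
  cell-act b left  (tape []      _ _)       ahead  zero          = refl
  cell-act b left  (tape (_ ∷ _) _ _)       ahead  zero          = refl
  cell-act b left  (tape []      _ _)       ahead  (suc zero)    = refl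
  cell-act b left  (tape (_ ∷ _) _ _)       ahead  (suc zero)    = refl
  cell-act b left  (tape []      _ _)       ahead  (suc (suc j)) = refl
  cell-act b left  (tape (_ ∷ _) _ _)       ahead  (suc (suc j)) = refl
  cell-act b left  (tape []      _ _)       behind j             = refl
  cell-act b left  (tape (_ ∷ _) _ _)       behind j             = refl

  scanned≡cell : ∀ (t : Tape Γ) → scanned t ≡ cell t ahead 0
  scanned≡cell (tape _ _ _) = refl

  -- A halted machine idles.
  moves : Q → Vec Γ (suc k) → Q × Vec (Γ × Move) (suc k)
  moves q g = fromMaybe (q , Vec.map (_, stay) g) (δ q g)

  heads : Config → Vec Γ (suc k)
  heads (_ , ts) = Vec.map scanned ts

  advance : Config → Config
  advance c@(q , ts) = proj₁ (moves q (heads c)) , Vec.zipWith act (proj₂ (moves q (heads c))) ts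

  advance-just : ∀ {c d} → step c ≡ just d → advance c ≡ d
  advance-just {q , ts} eq with δ q (Vec.map scanned ts)
  advance-just refl | just _ = refl

  zipWith-stay : ∀ {n} (ts : Vec (Tape Γ) n) → Vec.zipWith act (Vec.map (_, stay) (Vec.map scanned ts)) ts ≡ ts
  zipWith-stay []       = refl
  zipWith-stay (t ∷ ts) = cong (t ∷_) (zipWith-stay ts)

  advance-nothing : ∀ {c} → Halted c → advance c ≡ c
  advance-nothing {q , ts} eq with δ q (Vec.map scanned ts)
  ... | nothing = cong (q ,_) (zipWith-stay ts)

  -- Idling after the halt makes the configuration at every sufficiently late time the final one, so
  -- a run may be padded to a length that is a power of two.
  conf : Config → ℕ → Config
  conf c zero    = c
  conf c (suc τ) = advance (conf c τ)

  conf-advance : ∀ c τ → conf (advance c) τ ≡ conf c (suc τ)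
  conf-advance c zero    = refl
  conf-advance c (suc τ) = cong advance (conf-advance c τ)

  conf-next : ∀ {c d} → step c ≡ just d → ∀ τ → conf c (suc τ) ≡ conf d τ
  conf-next {c} eq τ = trans (sym (conf-advance c τ)) (cong (λ d → conf d τ) (advance-just eq))

  conf-halted : ∀ {c} → Halted c → ∀ τ → conf c τ ≡ c
  conf-halted h zero    = refl
  conf-halted h (suc τ) = trans (cong advance (conf-halted h τ)) (advance-nothing h)

  -- This carries the space bound, which speaks of configurations reached by steps, over to all
  -- times of the idling run.
  conf-reached : ∀ {c t d} → c ↝[ t ] d → Halted d → ∀ τ → ∃[ s ] c ↝[ s ] conf c τ
  conf-reached done h τ rewrite conf-halted h τ = 0 , done
  conf-reached (next eq r) h zero = 0 , done
  conf-reached {c} (next eq r) h (suc τ) with s , r′ ← conf-reached r h τ =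
    suc s , subst (c ↝[ suc s ]_) (sym (conf-next eq τ)) (next eq r′)

  conf-final : ∀ {c t d} → c ↝[ t ] d → Halted d → ∀ {τ} → t ≤ τ → conf c τ ≡ d
  conf-final done h {τ} _ = conf-halted h τ
  conf-final {c} (next eq r) h {suc τ} (s≤s t≤τ) =
    trans (conf-next eq τ) (conf-final r h t≤τ)

  running : ∀ {c t d} → c ↝[ t ] d → ∀ {τ} → τ < t → ¬ Halted (conf c τ)
  running (next eq r) {zero} _ h with () ← trans (sym eq) h
  running {c} (next eq r) {suc τ} (s≤s τ<t) h =
    running r τ<t (subst Halted (conf-next eq τ) h)

  conf-+ : ∀ c σ τ → conf (conf c σ) τ ≡ conf c (τ + σ)
  conf-+ c σ zero    = refl
  conf-+ c σ (suc τ) = cong advance (conf-+ c σ τ)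

  -- Configurations up to the listing of blank cells

  infix 4 _≈_

  -- Equality would be too fine for the counting argument: tapes with the same contents can list
  -- different numbers of blank cells. `advance` and halting respect this relation, which is all
  -- that is needed to repeat a run.
  _≈_ : Config → Config → Set
  (q , ts) ≈ (q′ , ts′) = q ≡ q′ × (∀ t d j → cell (lookup ts t) d j ≡ cell (lookup ts′ t) d j)

  heads-cong : ∀ {c d} → c ≈ d → heads c ≡ heads d
  heads-cong {_ , ts} {_ , ts′} (_ , eq) = lookup-ext _ _ λ t → begin
    lookup (Vec.map scanned ts) t   ≡⟨ Vec.lookup-map t scanned ts ⟩
    scanned (lookup ts t)           ≡⟨ scanned≡cell (lookup ts t) ⟩
    cell (lookup ts t) ahead 0      ≡⟨ eq t ahead 0 ⟩
    cell (lookup ts′ t) ahead 0     ≡⟨ scanned≡cell (lookup ts′ t) ⟨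
    scanned (lookup ts′ t)          ≡⟨ Vec.lookup-map t scanned ts′ ⟨
    lookup (Vec.map scanned ts′) t  ∎
    where open ≡-Reasoning

  cell-advance : ∀ (c : Config) t d j →
    let b , m = lookup (proj₂ (moves (proj₁ c) (heads c))) t in
    cell (lookup (proj₂ (advance c)) t) d j
    ≡ maybe′ (λ (d′ , j′) → cell (lookup (proj₂ c) t) d′ j′) b (source m d j)
  cell-advance c@(q , ts) t d j
    rewrite Vec.lookup-zipWith act t (proj₂ (moves q (heads c))) ts
    with b , m ← lookup (proj₂ (moves q (heads c))) t = cell-act b m (lookup ts t) d j

  advance-cong : ∀ {c d} → c ≈ d → advance c ≈ advance d
  advance-cong {c@(q , ts)} {c′@(_ , ts′)} eq@(refl , cells≡) =
    cong (λ g → proj₁ (moves q g)) (heads-cong {c} {c′} eq) , same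
    where
    same : ∀ t d j → cell (lookup (proj₂ (advance c)) t) d j ≡ cell (lookup (proj₂ (advance c′)) t) d j
    same t d j rewrite cell-advance c t d j | cell-advance c′ t d j | heads-cong {c} {c′} eq
      with b , m ← lookup (proj₂ (moves q (heads c′))) t with source m d j
    ... | nothing        = refl
    ... | just (d′ , j′) = cells≡ t d′ j′

  conf-cong : ∀ {c d} → c ≈ d → ∀ τ → conf c τ ≈ conf d τ
  conf-cong eq zero    = eq
  conf-cong {c} {d} eq (suc τ) = advance-cong {conf c τ} {conf d τ} (conf-cong eq τ)

  halted-cong : ∀ {c d} → c ≈ d → Halted c → Halted d
  halted-cong {c@(q , _)} {d} eq@(refl , _) h with δ q (heads c) in δc | δ q (heads d) in δd
  ... | nothing | nothing = refl
  ... | nothing | just _ with () ← trans (sym δc) (trans (cong (δ q) (heads-cong {c} {d} eq)) δd)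

  length≤cells : ∀ (t : Tape Γ) d {j} → length (cells t) ≤ j → cell t d j ≡ blank
  length≤cells (tape ls a rs) d {j} len = go d
    where
    open ≤-Reasoning
    len′ : length ls + length (a ∷ rs) ≤ j
    len′ = begin
      length ls + length (a ∷ rs)             ≡⟨ cong (_+ length (a ∷ rs)) (List.length-reverse ls) ⟨
      length (reverse ls) + length (a ∷ rs)   ≡⟨ List.length-++ (reverse ls) ⟨
      length (reverse ls ++ a ∷ rs)           ≤⟨ len ⟩
      j ∎
    go : ∀ d → cell (tape ls a rs) d j ≡ blank
    go ahead  = nth-≥ (a ∷ rs) (m+n≤o⇒n≤o (length ls) len′)
    go behind = nth-≥ ls (m+n≤o⇒m≤o (length ls) len′)

  lookup≤sum : ∀ {n} (ns : Vec ℕ n) i → lookup ns i ≤ Vec.sum ns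
  lookup≤sum (n ∷ ns) zero    = m≤m+n n _
  lookup≤sum (n ∷ ns) (suc i) = ≤-trans (lookup≤sum ns i) (m≤n+m _ n)

  blank-outside : ∀ (c : Config) t d {j} → space c ≤ j → cell (lookup (proj₂ c) t) d j ≡ blank
  blank-outside (_ , ts) t d space≤ = length≤cells (lookup ts t) d
    (≤-trans (subst (_≤ _) (Vec.lookup-map t (length ∘ cells) ts) (lookup≤sum (Vec.map (length ∘ cells) ts) t)) space≤)

  -- Configurations as sets of facts, and the halting time

  Attr : Set
  Attr = Q ⊎ (Bool × Fin (suc k) × Γ)

  finite-Attr : Finite Attr
  finite-Attr = finite-⊎ Q-fin (finite-× finite-Bool (finite-× (finite-Fin (suc k)) Γ-fin))

  -- A state is recorded at every position, so that facts about states and about cells are indexed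
  -- in the same way.
  Fact : Config → ℕ → Attr → Set
  Fact (q , _)  j (inj₁ q′)          = q ≡ q′
  Fact (_ , ts) j (inj₂ (d , t , a)) = cell (lookup ts t) d j ≡ a

  Fact? : ∀ c j α → Dec (Fact c j α)
  Fact? (q , _)  j (inj₁ q′)          = finite-≟ Q-fin q q′
  Fact? (_ , ts) j (inj₂ (d , t , a)) = finite-≟ Γ-fin (cell (lookup ts t) d j) a

  N : ℕ
  N = proj₁ finite-Attr

  place : ∀ S → Fin (suc S * N) → ℕ × Attr
  place S i = let j , α = remQuot {suc S} N i in toℕ j , Inverse.from (proj₂ finite-Attr) α

  place-onto : ∀ S {j} α → j ≤ S → ∃[ i ] place S i ≡ (j , α)
  place-onto S α j≤S = combine j′ α′ , trans
    (cong (λ (j , α) → toℕ j , Inverse.from (proj₂ finite-Attr) α) (Fin.remQuot-combine j′ α′))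
    (cong₂ _,_ (Fin.toℕ-fromℕ< (s≤s j≤S)) (Inverse.strictlyInverseʳ (proj₂ finite-Attr) α))
    where
    j′ = fromℕ< (s≤s j≤S)
    α′ = Inverse.to (proj₂ finite-Attr) α

  bit : Config → ℕ × Attr → Fin 2
  bit c (j , α) = if does (Fact? c j α) then suc zero else zero

  bit-Fact : ∀ c d jα → bit c jα ≡ bit d jα → Fact c (proj₁ jα) (proj₂ jα) → Fact d (proj₁ jα) (proj₂ jα)
  bit-Fact c d (j , α) eq fact with Fact? c j α | Fact? d j α
  bit-Fact c d (j , α) eq fact | _     | yes p = p
  bit-Fact c d (j , α) () fact | yes _ | no _
  bit-Fact c d (j , α) eq fact | no ¬p | no _  = ⊥-elim (¬p fact)

  -- The truth values of all facts at positions 0 to S, one bit for each. Under the space bound S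
  -- they determine a configuration up to `≈`, since all cells further away are blank.
  fingerprint : ∀ S → Config → Fin (2 ^ (suc S * N))
  fingerprint S c = funToFin (bit c ∘ place S)

  fingerprint-Fact : ∀ S c d → fingerprint S c ≡ fingerprint S d → ∀ {j α} → j ≤ S → Fact c j α → Fact d j α
  fingerprint-Fact S c d eq {j} {α} j≤S fact with i , refl ← place-onto S α j≤S =
    bit-Fact c d (place S i) bits fact
    where
    bits : bit c (place S i) ≡ bit d (place S i)
    bits = trans (sym (Fin.finToFun-funToFin (bit c ∘ place S) i))
             (trans (cong (λ e → finToFun e i) eq) (Fin.finToFun-funToFin (bit d ∘ place S) i))

  fingerprint-≈ : ∀ S c d → space c ≤ S → space d ≤ S → fingerprint S c ≡ fingerprint S d → c ≈ d
  fingerprint-≈ S c d c≤S d≤S eq =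
    sym (fingerprint-Fact S c d eq {α = inj₁ (proj₁ c)} z≤n refl) , same
    where
    same : ∀ t δ j → cell (lookup (proj₂ c) t) δ j ≡ cell (lookup (proj₂ d) t) δ j
    same t δ j with j ≤? S
    ... | yes j≤S = sym (fingerprint-Fact S c d eq {α = inj₂ (δ , t , _)} j≤S refl)
    ... | no  j≰S = trans (blank-outside c t δ (≤-trans c≤S (<⇒≤ (≰⇒> j≰S))))
                          (sym (blank-outside d t δ (≤-trans d≤S (<⇒≤ (≰⇒> j≰S)))))

  -- In a longer run two configurations, at times i < j within the run, have equal fingerprints.
  -- From there the run continues alike, so the halt at time t = σ + j also occurs at the earlier
  -- time σ + i, where the machine is still running.
  halting-time : ∀ S {c t d} → c ↝[ t ] d → Halted d → (∀ τ → space (conf c τ) ≤ S) → t ≤ 2 ^ (suc S * N)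
  halting-time S {c} {t} {d} r h in-S with t ≤? 2 ^ (suc S * N)
  ... | yes t≤ = t≤
  ... | no  t≰ with i , j , i<j , eq ← Fin.pigeonhole (n<1+n (2 ^ (suc S * N))) (λ i → fingerprint S (conf c (toℕ i))) =
    ⊥-elim (running r early (halted-cong {conf c (σ + toℕ j)} {conf c (σ + toℕ i)} periodic final))
    where
    j≤t : toℕ j ≤ t
    j≤t = ≤-trans (≤-pred (Fin.toℕ<n j)) (<⇒≤ (≰⇒> t≰))
    σ = t ∸ toℕ j
    final : Halted (conf c (σ + toℕ j))
    final = subst Halted (sym (conf-final r h (≤-reflexive (sym (m∸n+n≡m j≤t))))) h
    early : σ + toℕ i < t
    early = <-≤-trans (+-monoʳ-< σ i<j) (≤-reflexive (m∸n+n≡m j≤t))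
    periodic : conf c (σ + toℕ j) ≈ conf c (σ + toℕ i)
    periodic = subst₂ _≈_ (conf-+ c (toℕ j) σ) (conf-+ c (toℕ i) σ)
      (conf-cong {conf c (toℕ j)} {conf c (toℕ i)}
        (fingerprint-≈ S _ _ (in-S (toℕ j)) (in-S (toℕ i)) (sym eq)) σ)

-- Valuations of the atoms

module Numbering (Kind : Set) (Kind-fin : Finite Kind) (κ₀ : Kind) where

  K# : ℕ
  K# = proj₁ Kind-fin

  instance
    K#-nonZero : NonZero K#
    K#-nonZero = Fin.nonZeroIndex (Inverse.to (proj₂ Kind-fin) κ₀)

  code : Kind → ℕ
  code κ = toℕ (Inverse.to (proj₂ Kind-fin) κ)

  code<K# : ∀ κ → code κ < K#
  code<K# κ = Fin.toℕ<n (Inverse.to (proj₂ Kind-fin) κ)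

  position : ℕ → ℕ
  position i = i / K#

  kind : ℕ → Kind
  kind i = Inverse.from (proj₂ Kind-fin) (i mod K#)

  index : ℕ → Kind → ℕ
  index j κ = code κ + j * K#

  position-index : ∀ j κ → position (index j κ) ≡ j
  position-index j κ = begin
    (code κ + j * K#) / K#           ≡⟨ +-distrib-/-∣ʳ (code κ) (divides-refl j) ⟩
    code κ / K# + j * K# / K#        ≡⟨ cong₂ _+_ (m<n⇒m/n≡0 (code<K# κ)) (m*n/n≡m j K#) ⟩
    j                                ∎
    where open ≡-Reasoning

  kind-index : ∀ j κ → kind (index j κ) ≡ κ
  kind-index j κ = trans (cong (Inverse.from (proj₂ Kind-fin)) (Fin.toℕ-injective (begin
    toℕ ((code κ + j * K#) mod K#)   ≡⟨ Fin.toℕ-fromℕ< _ ⟩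
    (code κ + j * K#) % K#           ≡⟨ [m+kn]%n≡m%n (code κ) j K# ⟩
    code κ % K#                      ≡⟨ m<n⇒m%n≡m (code<K# κ) ⟩
    code κ                           ∎))) (Inverse.strictlyInverseʳ (proj₂ Kind-fin) κ)
    where open ≡-Reasoning

  open Instances Kind code K# public

-- A node of rank k + base is a node of level k; below base lies the part of
-- the model that only serves to interpret the atoms.
module Valuation
  (Kind : Set) (Kind-fin : Finite Kind) (κ₀ : Kind) (range : ℕ)
  (Truth : ℕ → ℕ → Bool → ℕ → Kind → Set)
  (Truth? : ∀ k τ s j κ → Dec (Truth k τ s j κ))
  where

  open Numbering Kind Kind-fin κ₀
  open Node

  -- Positions up to `range` have indices below `suc range * K#`. From this rank on, all of their
  -- atoms have the successors that give them a free value.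
  base : ℕ
  base = 2 + suc range * K#

  val : Node → ℕ → Bool
  val (node r τ s) i = does (base ≤? r) ∧ does (Truth? (r ∸ base) τ s (position i) (kind i))

  open Model (λ r → 2 ^ (r ∸ base)) val public

  index-range : ∀ {j} κ r → j ≤ range → base ≤ r → suc (index j κ) < r
  index-range {j} κ r j≤ base≤ = begin-strict
    suc (code κ) + j * K#   ≤⟨ +-monoˡ-≤ (j * K#) (code<K# κ) ⟩
    suc j * K#              ≤⟨ *-monoˡ-≤ K# (s≤s j≤) ⟩
    suc range * K#          <⟨ s≤s (n≤1+n _) ⟩
    base                    ≤⟨ base≤ ⟩
    r                       ∎
    where open ≤-Reasoning

  val-high : ∀ k τ s j κ → val (node (k + base) τ s) (index j κ) ≡ does (Truth? k τ s j κ)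
  val-high k τ s j κ
    rewrite dec-true (base ≤? k + base) (m≤n+m base k) | m+n∸n≡m k base
          | position-index j κ | kind-index j κ = refl

  true⇒ν : ∀ {k τ s j κ} → j ≤ range → Truth k τ s j κ → node (k + base) τ s ⊩ ν j κ
  true⇒ν {k} {τ} {s} {j} {κ} j≤ p = val⇒atom (index j κ) (node (k + base) τ s)
    (index-range κ (k + base) j≤ (m≤n+m base k)) (trans (val-high k τ s j κ) (dec-true (Truth? k τ s j κ) p))

  ν⇒true : ∀ {k τ s j κ} → j ≤ range → node (k + base) τ s ⊩ ν j κ → Truth k τ s j κ
  ν⇒true {k} {τ} {s} {j} {κ} j≤ p
    with Truth? k τ s j κ | trans (sym (val-high k τ s j κ)) (atom⇒val (index j κ) (node (k + base) τ s)
           (index-range κ (k + base) j≤ (m≤n+m base k)) p)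
  ... | yes q | _ = q

  -- Below `base` every index is valued false, so the atom fails at ranks above i + 1, where
  -- `atom⇒val` applies, and it fails up to rank i in any case. Only rank i + 1 remains.
  low-rank : ∀ i w → rank w < base → w ⊩ atom i → rank w ≡ suc i
  low-rank i w@(node r τ s) r< h with m≤n⇒m<n∨m≡n (atom⇒rank i w h)
  ... | inj₂ eq = sym eq
  ... | inj₁ 1+i<r with () ← trans (sym (atom⇒val i w 1+i<r h)) (cong (_∧ does (Truth? (r ∸ base) τ s (position i) (kind i)))
                               (dec-false (base ≤? r) (<⇒≱ r<)))

  low-unique : ∀ {j j′ κ κ′} w → rank w < base → w ⊩ ν j κ → w ⊩ ν j′ κ′ → κ ≡ κ′
  low-unique {j} {j′} {κ} {κ′} w r< h h′ = trans (sym (kind-index j κ)) (trans (cong kind same) (kind-index j′ κ′))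
    where
    same : index j κ ≡ index j′ κ′
    same = suc-injective (trans (sym (low-rank (index j κ) w r< h)) (low-rank (index j′ κ′) w r< h′))

  children : ∀ r τ {u} → u ∈ below (suc r) τ → rank u ≡ r → u ≡ node r τ false ⊎ u ≡ node r (τ + 2 ^ (r ∸ base)) true
  children r τ (here refl)         eq = inj₁ refl
  children r τ (there (here refl)) eq = inj₂ refl
  children r τ (there (there u∈))  eq with ∈-++⁻ (below r τ) u∈
  ... | inj₁ u∈ˡ = ⊥-elim (<-irrefl eq (below-rank r τ u∈ˡ))
  ... | inj₂ u∈ʳ = ⊥-elim (<-irrefl eq (below-rank r _ u∈ʳ))

-- The reduction

module _ {A B : Set} where

  all-concatMap : ∀ {P : B → Set} {f : A → List B} as → (∀ a → All P (f a)) → All P (concatMap f as)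
  all-concatMap as h = All.concat⁺ (All.map⁺ (All.universal h as))

  ∈-concatMap : ∀ (f : A → List B) {as a b} → a ∈ as → b ∈ f a → b ∈ concatMap f as
  ∈-concatMap f a∈ b∈ = ∈-concatMap⁺ f (lose a∈ b∈)

module _ {B : Set} where

  all-gather : ∀ {P : B → Set} i m {f} → (∀ j → j < i + m → All P (f j)) → All P (gather i m f)
  all-gather i zero    h = []
  all-gather i (suc m) h = All.++⁺ (h i (m<m+n i (s≤s z≤n)))
    (all-gather (suc i) m (λ j j< → h j (subst (j <_) (sym (+-suc i m)) j<)))

  ∈-gather : ∀ i m (f : ℕ → List B) {j b} → i ≤ j → j < i + m → b ∈ f j → b ∈ gather i m f
  ∈-gather i zero f {j} i≤j j< b∈ = ⊥-elim (<⇒≱ (subst (j <_) (+-identityʳ i) j<) i≤j)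
  ∈-gather i (suc m) f {j} i≤j j< b∈ with m≤n⇒m<n∨m≡n i≤j
  ... | inj₂ refl = ∈-++⁺ˡ b∈
  ... | inj₁ i<j  = ∈-++⁺ʳ (f i) (∈-gather (suc i) m f i<j (subst (j <_) (+-suc i m) j<) b∈)

-- Head moves as schematic shifts of cells

Place : Set
Place = Bool × Counter × ℕ

-- The graph of `source` as finitely many schemes in the inner counter, with the exceptional cells
-- near the head as constants. This is what makes a machine step expressible by a fixed list of
-- templates.
rules : Move → List (Maybe Place × Place)
rules stay =
  (nothing                    , (ahead  , none  , 0)) ∷
  (just (ahead  , inner , 1)  , (ahead  , inner , 1)) ∷
  (just (behind , inner , 0)  , (behind , inner , 0)) ∷ []
rules right =
  (just (ahead  , inner , 1)  , (ahead  , inner , 0)) ∷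
  (nothing                    , (behind , none  , 0)) ∷
  (just (behind , inner , 0)  , (behind , inner , 1)) ∷ []
rules left =
  (just (behind , none  , 0)  , (ahead  , none  , 0)) ∷
  (nothing                    , (ahead  , none  , 1)) ∷
  (just (ahead  , inner , 1)  , (ahead  , inner , 2)) ∷
  (just (behind , inner , 1)  , (behind , inner , 0)) ∷ []

locate : (Counter → ℕ) → Place → Bool × ℕ
locate e (d , c , o) = d , o + e c

rules-sound : ∀ v j i → All (λ (s , d , c , o) → Maybe.map (locate (env j i)) s ≡ source v d (o + env j i c)) (rules v)
rules-sound stay  j i = refl ∷ refl ∷ refl ∷ []
rules-sound right j i = refl ∷ refl ∷ refl ∷ []
rules-sound left  j i = refl ∷ refl ∷ refl ∷ refl ∷ []

-- The offsets carry the clauses up to two positions beyond m, where the atoms must still have their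
-- intended values in the countermodel.
rules-offset : ∀ v → All (λ (s , _ , _ , o) → o ≤ 2 × maybe′ (λ (_ , _ , o′) → o′ ≤ 2) ⊤ s) (rules v)
rules-offset stay  = (z≤n , tt) ∷ (s≤s z≤n , s≤s z≤n) ∷ (z≤n , z≤n) ∷ []
rules-offset right = (z≤n , s≤s z≤n) ∷ (z≤n , tt) ∷ (s≤s z≤n , z≤n) ∷ []
rules-offset left  = (z≤n , z≤n) ∷ (s≤s z≤n , tt) ∷ (≤-refl , s≤s z≤n) ∷ (z≤n , s≤s z≤n) ∷ []

Within : (Counter → ℕ) → ℕ → Maybe Place → Set
Within e m nothing            = ⊤
Within e m (just (_ , c , o)) = o + e c ≤ m

-- A move can fill cell j from cell j + 1, and the facts before the step are known only up to
-- position m; hence the strict bound on j.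
rules-complete : ∀ v d {j m} → j < m →
  ∃[ i ] ∃[ s ] ∃[ p ] (i ≤ m × (s , p) ∈ rules v × locate (env 0 i) p ≡ (d , j) × Within (env 0 i) m s)
rules-complete stay  ahead  {zero}        j<m = 0 , _ , _ , z≤n , here refl , refl , tt
rules-complete stay  ahead  {suc j}       j<m = j , _ , _ , <⇒≤ (<⇒≤ j<m) , there (here refl) , refl , <⇒≤ j<m
rules-complete stay  behind {j}           j<m = j , _ , _ , <⇒≤ j<m , there (there (here refl)) , refl , <⇒≤ j<m
rules-complete right ahead  {j}           j<m = j , _ , _ , <⇒≤ j<m , here refl , refl , j<m
rules-complete right behind {zero}        j<m = 0 , _ , _ , z≤n , there (here refl) , refl , tt
rules-complete right behind {suc j}       j<m = j , _ , _ , <⇒≤ (<⇒≤ j<m) , there (there (here refl)) , refl , <⇒≤ (<⇒≤ j<m)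
rules-complete left  ahead  {zero}        j<m = 0 , _ , _ , z≤n , here refl , refl , z≤n
rules-complete left  ahead  {suc zero}    j<m = 0 , _ , _ , z≤n , there (here refl) , refl , tt
rules-complete left  ahead  {suc (suc j)} j<m =
  j , _ , _ , <⇒≤ (<⇒≤ (<⇒≤ j<m)) , there (there (here refl)) , refl , <⇒≤ (<⇒≤ j<m)
rules-complete left  behind {j}           j<m = j , _ , _ , <⇒≤ j<m , there (there (there (here refl))) , refl , j<m

pattern level  = inj₁ zero
pattern guard  = inj₁ (suc zero)
pattern first  = inj₁ (suc (suc zero))
pattern second = inj₁ (suc (suc (suc zero)))
pattern old α  = inj₂ (false , α)
pattern new α  = inj₂ (true , α)

module Reduction {A : Set} (A-fin : Finite A) {L : Language A} (P : PSPACE L) where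

  open PSPACE P
  open Dynamics machine

  Kind : Set
  Kind = Fin 4 ⊎ (Bool × Attr)

  finite-Kind : Finite Kind
  finite-Kind = finite-⊎ (finite-Fin 4) (finite-× finite-Bool finite-Attr)

  open Numbering Kind finite-Kind level

  -- Levels count from 0 at the leaves; two atoms are needed as a guard.
  guarded : Counter → ℕ → Template Kind → Template Kind
  guarded c o T = var c o level ⇒ᵀ var none 0 guard ⇒ᵀ T

  -- The box ranges over all successors, not only the next ones. The level premise picks out the two
  -- children of a node one level higher, and s picks one of them.
  child : Kind → Template Kind → Template Kind
  child s T = □ᵀ (guarded outer 0 (var none 0 s ⇒ᵀ T))

  -- Facts flow into the first half, across the midpoint, and out of the second half. Premises about
  -- a child are boxes, so what is derived in the theory of a child becomes usable at its parent.
  halving : Attr → List (Template Kind)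
  halving α =
    guarded outer 1 (var inner 0 (old α) ⇒ᵀ child first (var inner 0 (old α))) ∷
    guarded outer 1 (child first (var inner 0 (new α)) ⇒ᵀ child second (var inner 0 (old α))) ∷
    guarded outer 1 (child second (var inner 0 (new α)) ⇒ᵀ var inner 0 (new α)) ∷ []

  reading-heads : Vec Γ (suc k) → Template Kind → List (Fin (suc k)) → Template Kind
  reading-heads g = foldr (λ t T → var none 0 (old (inj₂ (ahead , t , lookup g t))) ⇒ᵀ T)

  reading : Q → Vec Γ (suc k) → Template Kind → Template Kind
  reading q g T = var none 0 (old (inj₁ q)) ⇒ᵀ reading-heads g T (allFin (suc k))

  effect : Fin (suc k) → Γ → Maybe Place × Place → List (Template Kind)
  effect t b (nothing , (d , c , o)) = var c o (new (inj₂ (d , t , b))) ∷ []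
  effect t b (just (d′ , c′ , o′) , (d , c , o)) =
    map (λ a → var c′ o′ (old (inj₂ (d′ , t , a))) ⇒ᵀ var c o (new (inj₂ (d , t , a)))) (enum Γ-fin)

  tape-effects : Vec (Γ × Move) (suc k) → Fin (suc k) → List (Template Kind)
  tape-effects as t = concatMap (effect t (proj₁ (lookup as t))) (rules (proj₂ (lookup as t)))

  effects : Q × Vec (Γ × Move) (suc k) → List (Template Kind)
  effects (q , as) = var inner 0 (new (inj₁ q)) ∷ concatMap (tape-effects as) (allFin (suc k))

  transition : Q → Vec Γ (suc k) → List (Template Kind)
  transition q g = map (guarded none 0 ∘ reading q g) (effects (moves q g))

  transitions : Q → List (Template Kind)
  transitions q = concatMap (transition q) (enum (finite-Vec Γ-fin (suc k)))

  -- The transition clauses do not mention `outer` and are just repeated for each of its values,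
  -- which spares the generator another loop.
  inside : List (Template Kind)
  inside = concatMap halving (enum finite-Attr) ++ concatMap transitions (enum Q-fin)

  -- The shifts do not reach position m, but there the space bound makes the cells blank.
  edges : Fin (suc k) → List (Template Kind)
  edges t = guarded none 0 (var outer 0 (new (inj₂ (ahead , t , blank)))) ∷
            guarded none 0 (var outer 0 (new (inj₂ (behind , t , blank)))) ∷ []

  edge : List (Template Kind)
  edge = concatMap edges (allFin (suc k))

  -- For an accepting state, the hypothesis that the run does not end in it; deriving ⊥ then amounts
  -- to deriving acceptance.
  rejecting : Q → List (Template Kind)
  rejecting q = if accept q then (var none 0 (new (inj₁ q)) ⇒ᵀ ⊥ᵀ) ∷ [] else []

  opening : List (Template Kind)
  opening = var outer 0 level ∷ var none 0 guard ∷ concatMap rejecting (enum Q-fin)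

  sides : List (Template Kind)
  sides = var inner 0 (old (inj₁ start)) ∷
    map (λ t → var inner 0 (old (inj₂ (behind , t , blank)))) (allFin (suc k)) ++
    map (λ t → var inner 0 (old (inj₂ (ahead , suc t , blank)))) (allFin k)

  letter : A → Γ
  letter = Injection.to (proj₁ input)

  symbol : A → List (Template Kind)
  symbol a = var inner 0 (old (inj₂ (ahead , zero , letter a))) ∷ []

  blanks : List (Template Kind)
  blanks = var inner 0 (old (inj₂ (ahead , zero , blank))) ∷ []

  -- One number bounds both the levels and the cells. The product is the exponent in `halting-time`,
  -- `bound` takes position m beyond all used cells, and the summand 1 ensures that the double loop,
  -- which also prints the transition clauses, is entered.
  size : Polynomial
  size = (1 ∷ []) +ᴾ (bound +ᴾ ((1 ∷ []) +ᴾ bound) *ᴾ (N ∷ []))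

  open Generator A A-fin Kind code K# size (map □ᵀ_ inside) (map □ᵀ_ edge) opening sides blanks symbol
    using (symbols; clauses; hypotheses; formula; formula-polyTime)

  module Instance (w : List A) where

    n S m : ℕ
    n = length w
    S = ⟦ bound ⟧ n
    m = ⟦ size ⟧ n

    m≡ : m ≡ 1 + (S + suc S * N)
    m≡ = begin
      ⟦ size ⟧ n                                                           ≡⟨ ⟦+ᴾ⟧ (1 ∷ []) (bound +ᴾ ((1 ∷ []) +ᴾ bound) *ᴾ (N ∷ [])) n ⟩
      ⟦ 1 ∷ [] ⟧ n + ⟦ bound +ᴾ ((1 ∷ []) +ᴾ bound) *ᴾ (N ∷ []) ⟧ n         ≡⟨ cong₂ _+_ (constant 1) (⟦+ᴾ⟧ bound _ n) ⟩
      1 + (S + ⟦ ((1 ∷ []) +ᴾ bound) *ᴾ (N ∷ []) ⟧ n)                      ≡⟨ cong (λ a → 1 + (S + a)) (⟦*ᴾ⟧ ((1 ∷ []) +ᴾ bound) (N ∷ []) n) ⟩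
      1 + (S + ⟦ (1 ∷ []) +ᴾ bound ⟧ n * ⟦ N ∷ [] ⟧ n)                     ≡⟨ cong₂ (λ a b → 1 + (S + a * b)) (⟦+ᴾ⟧ (1 ∷ []) bound n) (constant N) ⟩
      1 + (S + (⟦ 1 ∷ [] ⟧ n + S) * N)                                     ≡⟨ cong (λ a → 1 + (S + (a + S) * N)) (constant 1) ⟩
      1 + (S + suc S * N)                                                  ∎
      where
      open ≡-Reasoning
      constant : ∀ a → ⟦ a ∷ [] ⟧ n ≡ a
      constant a = trans (cong (a +_) (*-zeroʳ n)) (+-identityʳ a)

    0<m : 0 < m
    0<m = subst (0 <_) (sym m≡) (s≤s z≤n)

    S≤m : S ≤ m
    S≤m = subst (S ≤_) (sym m≡) (m≤n⇒m≤1+n (m≤m+n S _))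

    c₀ : Config
    c₀ = initial (word input w)

    at : ℕ → Config
    at = conf c₀

    run = proj₂ (proj₂ (decides w))

    final : Config
    final = proj₁ (proj₂ (decides w))

    in-S : ∀ τ → space (at τ) ≤ S
    in-S τ = in-space w (proj₂ (conf-reached (proj₁ run) (proj₁ (proj₂ run)) τ))

    at-2^m : at (2 ^ m) ≡ final
    at-2^m = conf-final (proj₁ run) (proj₁ (proj₂ run))
      (≤-trans (halting-time S (proj₁ run) (proj₁ (proj₂ run)) in-S)
               (^-monoʳ-≤ 2 (subst (suc S * N ≤_) (sym m≡) (m≤n⇒m≤1+n (m≤n+m (suc S * N) S)))))

    edge-blank : ∀ τ t d → cell (lookup (proj₂ (at τ)) t) d m ≡ blank
    edge-blank τ t d = blank-outside (at τ) t d (≤-trans (in-S τ) S≤m)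

    at-suc : ∀ τ → at (τ + 1) ≡ advance (at τ)
    at-suc τ = cong at (+-comm τ 1)

    initial-ahead : ∀ j → cell (lookup (proj₂ c₀) zero) ahead j ≡ nth (map letter w) j
    initial-ahead j with map letter w
    initial-ahead zero    | []     = refl
    initial-ahead (suc j) | []     = refl
    initial-ahead j       | _ ∷ _  = refl

    initial-behind : ∀ t j → cell (lookup (proj₂ c₀) t) behind j ≡ blank
    initial-behind zero    j with map letter w
    ... | []    = refl
    ... | _ ∷ _ = refl
    initial-behind (suc t) j rewrite Vec.lookup-replicate t emptyTape = refl

    initial-other : ∀ t j → cell (lookup (proj₂ c₀) (suc t)) ahead j ≡ blank
    initial-other t j rewrite Vec.lookup-replicate t emptyTape with j
    ... | zero  = refl
    ... | suc _ = refl

    symbols-∈ : ∀ v i {j} → j < length v →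
                ν (j + i) (old (inj₂ (ahead , zero , nth (map letter v) j))) ∈ symbols m i v
    symbols-∈ (a ∷ v) i {zero}  _         = here refl
    symbols-∈ (a ∷ v) i {suc j} (s≤s j<) = there
      (subst (λ l → ν l (old (inj₂ (ahead , zero , nth (map letter v) j))) ∈ symbols m (suc i) v)
        (+-suc j i) (symbols-∈ v (suc i) j<))

    symbols-All : ∀ {P : Formula → Set} v i →
                  (∀ j → j < length v → P (ν (j + i) (old (inj₂ (ahead , zero , nth (map letter v) j))))) →
                  All P (symbols m i v)
    symbols-All [] i h = []
    symbols-All {P} (a ∷ v) i h = h 0 (s≤s z≤n) ∷ symbols-All v (suc i)
      (λ j j< → subst (λ l → P (ν l (old (inj₂ (ahead , zero , nth (map letter v) j))))) (sym (+-suc j i)) (h (suc j) (s≤s j<)))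

    -- Derivation

    -- Having each clause together with its box is what survives the descent through the tree:
    -- unboxing turns the box into the clause, and `box-4` provides the box again.
    Good : Theory → Set
    Good T = ∀ {B} → (□ B) ∈ clauses m → Mem T B × Mem T (□ B)

    good-⊕ : ∀ T B → Good T → Good (T ⊕ B)
    good-⊕ T B good c∈ = ⊕-⊆ T B (proj₁ (good c∈)) , ⊕-⊆ T B (proj₂ (good c∈))

    good-unbox : ∀ T → Good T → Good (unbox T)
    good-unbox T good c∈ = proj₂ (good c∈) , box-4 T (proj₂ (good c∈))

    inside-∈ : ∀ {j i U} → j < m → i ≤ m → U ∈ inside → (□ (inst (env j i) U)) ∈ clauses m
    inside-∈ {j} {i} j<m i≤m U∈ = ∈-++⁺ˡ (∈-gather 0 m _ z≤n j<m
      (∈-gather 0 (suc m) (λ i → insts (env j i) (map □ᵀ_ inside)) z≤n (s≤s i≤m) (∈-map⁺ (inst (env j i)) (∈-map⁺ □ᵀ_ U∈))))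

    edge-∈ : ∀ {U} → U ∈ edge → (□ (inst (env m 0) U)) ∈ clauses m
    edge-∈ U∈ = ∈-++⁺ʳ (gather 0 m _) (∈-map⁺ (inst (env m 0)) (∈-map⁺ □ᵀ_ U∈))

    halving-∈ : ∀ α {U} → U ∈ halving α → U ∈ inside
    halving-∈ α U∈ = ∈-++⁺ˡ (∈-concatMap halving (∈-enum finite-Attr α) U∈)

    transition-∈ : ∀ q g {U} → U ∈ effects (moves q g) → guarded none 0 (reading q g U) ∈ inside
    transition-∈ q g U∈ = ∈-++⁺ʳ (concatMap halving (enum finite-Attr))
      (∈-concatMap transitions (∈-enum Q-fin q) (∈-concatMap (transition q) (∈-enum (finite-Vec Γ-fin (suc k)) g)
        (∈-map⁺ (guarded none 0 ∘ reading q g) U∈)))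

    Old New : Theory → ℕ → Set
    Old T τ = ∀ {j} α → j ≤ m → Fact (at τ) j α → Mem T (ν j (old α))
    New T τ = ∀ {j} α → j ≤ m → Fact (at τ) j α → Mem T (ν j (new α))

    module Bottom (T : Theory) (τ : ℕ) (good : Good T)
                  (lev : Mem T (ν 0 level)) (grd : Mem T (ν 0 guard)) (olds : Old T τ) where
      open Theory T hiding (Mem)

      c : Config
      c = at τ

      q = proj₁ c
      g = heads c
      as = proj₂ (moves q g)

      read : ∀ i U ts → Mem T (inst (env 0 i) (reading-heads g U ts)) → Mem T (inst (env 0 i) U)
      read i U []       p = p
      read i U (t ∷ ts) p = read i U ts (p · olds (inj₂ (ahead , t , lookup g t)) z≤n
        (trans (sym (scanned≡cell (lookup (proj₂ c) t))) (sym (Vec.lookup-map t scanned (proj₂ c)))))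

      fire : ∀ {i U} → i ≤ m → U ∈ effects (moves q g) → Mem T (inst (env 0 i) U)
      fire {i} {U} i≤m U∈ = read i U (allFin (suc k))
        (proj₁ (good (inside-∈ 0<m i≤m (transition-∈ q g U∈))) · lev · grd · olds (inj₁ q) z≤n refl)

      news : New T (suc τ)
      news (inj₁ q′) j≤m refl = fire j≤m (here refl)
      news {j} (inj₂ (d , t , a)) j≤m fact with m≤n⇒m<n∨m≡n j≤m
      ... | inj₂ refl = subst (λ a → Mem T (ν m (new (inj₂ (d , t , a))))) (trans (sym (edge-blank (suc τ) t d)) fact)
        (proj₁ (good (edge-∈ (∈-concatMap edges (∈-allFin t) (edges-∈ d)))) · lev · grd)
        where
        edges-∈ : ∀ d → guarded none 0 (var outer 0 (new (inj₂ (d , t , blank)))) ∈ edges t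
        edges-∈ ahead  = here refl
        edges-∈ behind = there (here refl)
      ... | inj₁ j<m with i , s , p , i≤m , r∈ , refl , within ← rules-complete (proj₂ (lookup as t)) d j<m =
        from-rule s r∈ within (All.lookup (rules-sound (proj₂ (lookup as t)) 0 i) r∈)
        where
        tape-∈ : ∀ {s U} → (s , p) ∈ rules (proj₂ (lookup as t)) → U ∈ effect t (proj₁ (lookup as t)) (s , p) →
                 U ∈ effects (moves q g)
        tape-∈ r∈ U∈ = there (∈-concatMap (tape-effects as) (∈-allFin t) (∈-concatMap (effect t (proj₁ (lookup as t))) r∈ U∈))
        value : ∀ {s} → Maybe.map (locate (env 0 i)) s ≡ source (proj₂ (lookup as t)) d j →
                maybe′ (λ (d′ , j′) → cell (lookup (proj₂ c) t) d′ j′) (proj₁ (lookup as t)) (Maybe.map (locate (env 0 i)) s) ≡ a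
        value eq = trans (cong (maybe′ _ _) eq) (trans (sym (cell-advance c t d j)) fact)
        from-rule : ∀ s → (s , p) ∈ rules (proj₂ (lookup as t)) → Within (env 0 i) m s →
                    Maybe.map (locate (env 0 i)) s ≡ source (proj₂ (lookup as t)) d j → Mem T (ν j (new (inj₂ (d , t , a))))
        from-rule nothing r∈ _ eq with refl ← value {nothing} eq = fire i≤m (tape-∈ r∈ (here refl))
        from-rule (just p′) r∈ within eq =
          fire i≤m (tape-∈ r∈ (∈-map⁺ _ (∈-enum Γ-fin a))) · olds (inj₂ (proj₁ p′ , t , a)) within (value {just p′} eq)

    -- The theory varies in the induction, because the hypothesis is applied in the theories of the
    -- two children. These inherit from T only what is boxed there; what they know about the
    -- configuration arrives through the halving clauses.
    climb : ∀ l T τ → l ≤ m → Good T → Mem T (ν l level) → Mem T (ν 0 guard) → Old T τ → New T (τ + 2 ^ l)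
    climb zero T τ l≤m good lev grd olds {j} α j≤m fact =
      Bottom.news T τ good lev grd olds α j≤m (subst (λ c → Fact c j α) (at-suc τ) fact)
    climb (suc l) T τ l<m good lev grd olds {j} α j≤m fact =
      use α j≤m (there (there (here refl))) · news₂ α j≤m
        (subst (λ σ → Fact (at σ) j α) (trans (cong (λ a → τ + (2 ^ l + a)) (+-identityʳ (2 ^ l))) (sym (+-assoc τ (2 ^ l) (2 ^ l)))) fact)
      where
      open Theory T hiding (Mem)
      use : ∀ {j U} α → j ≤ m → guarded outer 1 U ∈ halving α → Mem T (inst (env l j) U)
      use α j≤m U∈ = proj₁ (good (inside-∈ l<m j≤m (halving-∈ α U∈))) · lev · grd
      -- Membership of B here is, by definition, membership in T of the box of B under the three
      -- premises of `child s`. So the halving clauses translate between T and the children without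
      -- further work.
      T′ : Kind → Theory
      T′ s = unbox T ⊕ ν l level ⊕ ν 0 guard ⊕ ν 0 s
      good′ : ∀ s → Good (T′ s)
      good′ s = good-⊕ (unbox T ⊕ ν l level ⊕ ν 0 guard) (ν 0 s)
        (good-⊕ (unbox T ⊕ ν l level) (ν 0 guard) (good-⊕ (unbox T) (ν l level) (good-unbox T good)))
      lev′ : ∀ s → Mem (T′ s) (ν l level)
      lev′ s = ⊕-⊆ (unbox T ⊕ ν l level ⊕ ν 0 guard) (ν 0 s) (⊕-⊆ (unbox T ⊕ ν l level) (ν 0 guard) (⊕-∈ (unbox T) (ν l level)))
      grd′ : ∀ s → Mem (T′ s) (ν 0 guard)
      grd′ s = ⊕-⊆ (unbox T ⊕ ν l level ⊕ ν 0 guard) (ν 0 s) (⊕-∈ (unbox T ⊕ ν l level) (ν 0 guard))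
      olds₁ : Old (T′ first) τ
      olds₁ α j≤m fact = use α j≤m (here refl) · olds α j≤m fact
      news₁ : New (T′ first) (τ + 2 ^ l)
      news₁ = climb l (T′ first) τ (<⇒≤ l<m) (good′ first) (lev′ first) (grd′ first) olds₁
      olds₂ : Old (T′ second) (τ + 2 ^ l)
      olds₂ α j≤m fact = use α j≤m (there (here refl)) · news₁ α j≤m fact
      news₂ : New (T′ second) (τ + 2 ^ l + 2 ^ l)
      news₂ = climb l (T′ second) (τ + 2 ^ l) (<⇒≤ l<m) (good′ second) (lev′ second) (grd′ second) olds₂

    opening-∈ : ∀ {U} → U ∈ opening → inst (env m 0) U ∈ hypotheses m w
    opening-∈ U∈ = ∈-++⁺ˡ (∈-map⁺ (inst (env m 0)) U∈)

    sides-∈ : ∀ {i U} → i ≤ m → U ∈ sides → inst (env m i) U ∈ hypotheses m w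
    sides-∈ {i} i≤m U∈ = ∈-++⁺ʳ (map (inst (env m 0)) opening) (∈-++⁺ˡ
      (∈-gather 0 (suc m) (λ i → insts (env m i) sides) z≤n (s≤s i≤m) (∈-map⁺ (inst (env m i)) U∈)))

    input-∈ : ∀ {B} → B ∈ symbols m 0 w ++ gather n (suc m) (λ i → insts (env m i) blanks) → B ∈ hypotheses m w
    input-∈ B∈ = ∈-++⁺ʳ (map (inst (env m 0)) opening)
      (∈-++⁺ʳ (gather 0 (suc m) (λ i → insts (env m i) sides)) B∈)

    initial-∈ : ∀ {j} α → j ≤ m → Fact (at 0) j α → ν j (old α) ∈ hypotheses m w
    initial-∈ (inj₁ q) j≤m refl = sides-∈ j≤m (here refl)
    initial-∈ {j} (inj₂ (behind , t , a)) j≤m fact with refl ← trans (sym fact) (initial-behind t j) =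
      sides-∈ j≤m (there (∈-++⁺ˡ (∈-map⁺ _ (∈-allFin t))))
    initial-∈ {j} (inj₂ (ahead , suc t , a)) j≤m fact with refl ← trans (sym fact) (initial-other t j) =
      sides-∈ j≤m (there (∈-++⁺ʳ (map _ (allFin (suc k))) (∈-map⁺ _ (∈-allFin t))))
    initial-∈ {j} (inj₂ (ahead , zero , a)) j≤m fact with refl ← trans (sym fact) (initial-ahead j) | j <? n
    ... | yes j<n = input-∈ (∈-++⁺ˡ
      (subst (λ l → ν l (old (inj₂ (ahead , zero , nth (map letter w) j))) ∈ symbols m 0 w) (+-identityʳ j) (symbols-∈ w 0 j<n)))
    ... | no  j≮n = input-∈ (∈-++⁺ʳ (symbols m 0 w)
      (subst (λ a → ν j (old (inj₂ (ahead , zero , a))) ∈ gather n (suc m) (λ i → insts (env m i) blanks))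
        (sym (nth-≥ (map letter w) (subst (_≤ j) (sym (List.length-map letter w)) (≮⇒≥ j≮n))))
        (∈-gather n (suc m) (λ i → insts (env m i) blanks) (≮⇒≥ j≮n) (<-≤-trans (s≤s j≤m) (m≤n+m (suc m) n)) (here refl))))

    provable : accept (proj₁ final) ≡ true → IL⊢ formula w
    provable accepted = discharge IL (clauses m) λ T _ cs → discharge (unbox T) (hypotheses m w) λ U T⊆U hs →
      let
        open Theory U using (_·_)
        good : Good U
        good c∈ = T⊆U (All.lookup cs c∈) , T⊆U (box-4 T (All.lookup cs c∈))
        reached : Mem U (ν 0 (new (inj₁ (proj₁ final))))
        reached = climb m U 0 ≤-refl good (All.lookup hs (opening-∈ (here refl))) (All.lookup hs (opening-∈ (there (here refl))))
          (λ α j≤m fact → All.lookup hs (initial-∈ α j≤m fact)) (inj₁ (proj₁ final)) z≤n (cong proj₁ at-2^m)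
      in All.lookup hs (opening-∈ (there (there (∈-concatMap rejecting (∈-enum Q-fin (proj₁ final)) rejected)))) · reached
      where
      rejected : (var none 0 (new (inj₁ (proj₁ final))) ⇒ᵀ ⊥ᵀ) ∈ rejecting (proj₁ final)
      rejected rewrite accepted = here refl

    -- Countermodel

    -- The blank hypotheses reach position n + m, and the shifts reach m + 2.
    range : ℕ
    range = n + m + 2

    -- A node of level l describes the actual run between the times τ and τ + 2^l. Acceptance does
    -- not enter, so the clauses hold for every input, and rejection matters only for the hypotheses
    -- at the root.
    Truth : ℕ → ℕ → Bool → ℕ → Kind → Set
    Truth l τ s j level   = j ≡ l
    Truth l τ s j guard   = ⊤
    Truth l τ s j first   = s ≡ false
    Truth l τ s j second  = s ≡ true
    Truth l τ s j (old α) = Fact (at τ) j α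
    Truth l τ s j (new α) = Fact (at (τ + 2 ^ l)) j α

    Truth? : ∀ l τ s j κ → Dec (Truth l τ s j κ)
    Truth? l τ s j level   = j ℕ.≟ l
    Truth? l τ s j guard   = yes tt
    Truth? l τ s j first   = s Bool.≟ false
    Truth? l τ s j second  = s Bool.≟ true
    Truth? l τ s j (old α) = Fact? (at τ) j α
    Truth? l τ s j (new α) = Fact? (at (τ + 2 ^ l)) j α

    open Valuation Kind finite-Kind level range Truth Truth?
    open Node using (rank)

    high-level : ∀ {l} w → l ≤ range → w ⊩ ν l level → w ⊩ ν 0 guard → rank w ≡ l + base
    high-level {l} w@(node r τ s) l≤ lev grd with base ≤? r
    ... | no base≰r with () ← low-unique {l} {0} {level} {guard} w (≰⇒> base≰r) lev grd
    ... | yes base≤r with r ∸ base | m∸n+n≡m base≤r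
    ... | l′ | refl = cong (_+ base) (sym (ν⇒true {l′} {τ} {s} {l} {level} l≤ lev))

    guarded-sound : ∀ l B → l ≤ range → (∀ τ s → node (l + base) τ s ⊩ B) → ∀ w → w ⊩ (ν l level ⇒ ν 0 guard ⇒ B)
    guarded-sound l B l≤ h w@(node r τ s) lev grd with refl ← high-level {l} w l≤ lev grd = h τ s

    -- Among all successors, the two premises leave only those of rank `l + base`, and these are the
    -- two children.
    box-sound : ∀ {l τ s B} → l ≤ range →
                node (l + base) τ false ⊩ B → node (l + base) (τ + 2 ^ l) true ⊩ B →
                node (suc l + base) τ s ⊩ (□ (ν l level ⇒ ν 0 guard ⇒ B))
    box-sound {l} {τ} {B = B} l≤ h₁ h₂ =
      All.tabulate λ {u} u∈ lev grd → cases (children (l + base) τ u∈ (high-level {l} u l≤ lev grd))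
      where
      cases : ∀ {u} → u ≡ node (l + base) τ false ⊎ u ≡ node (l + base) (τ + 2 ^ (l + base ∸ base)) true → u ⊩ B
      cases (inj₁ refl) = h₁
      cases (inj₂ refl) rewrite m+n∸n≡m l base = h₂

    box-first : ∀ {l τ s B} → l ≤ range → node (suc l + base) τ s ⊩ (□ (ν l level ⇒ ν 0 guard ⇒ B)) →
                node (l + base) τ false ⊩ B
    box-first {l} l≤ (h ∷ _) = h (true⇒ν {l} {j = l} {level} l≤ refl) (true⇒ν {l} {j = 0} {guard} z≤n tt)

    box-second : ∀ {l τ s B} → l ≤ range → node (suc l + base) τ s ⊩ (□ (ν l level ⇒ ν 0 guard ⇒ B)) →
                 node (l + base) (τ + 2 ^ l) true ⊩ B
    box-second {l} {τ} {B = B} l≤ (_ ∷ h ∷ _) =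
      subst (λ d → node (l + base) (τ + 2 ^ d) true ⊩ (ν l level ⇒ ν 0 guard ⇒ B)) (m+n∸n≡m l base) h
        (true⇒ν {l} {j = l} {level} l≤ refl) (true⇒ν {l} {j = 0} {guard} z≤n tt)

    m≤range : m ≤ range
    m≤range = ≤-trans (m≤n+m m n) (m≤m+n (n + m) 2)

    halving-sound : ∀ {j i} α → j < m → i ≤ m → All (λ U → ∀ u → u ⊩ inst (env j i) U) (halving α)
    halving-sound {j} {i} α j<m i≤m =
      guarded-sound (suc j) (ν i (old α) ⇒ down first (ν i (old α))) j+1≤ (λ τ s h →
        box-sound {j} {τ} {s} {ν 0 first ⇒ ν i (old α)} j≤
          (λ _ → true⇒ν {j} {τ} {false} {i} {old α} i≤ (ν⇒true {suc j} {τ} {s} {i} {old α} i≤ h))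
          (λ f → ⊥-elim (true≢false (ν⇒true {j} {τ + 2 ^ j} {true} {0} {first} z≤n f)))) ∷
      guarded-sound (suc j) (down first (ν i (new α)) ⇒ down second (ν i (old α))) j+1≤ (λ τ s h →
        box-sound {j} {τ} {s} {ν 0 second ⇒ ν i (old α)} j≤
          (λ f → ⊥-elim (true≢false (sym (ν⇒true {j} {τ} {false} {0} {second} z≤n f))))
          (λ _ → true⇒ν {j} {τ + 2 ^ j} {true} {i} {old α} i≤
            (ν⇒true {j} {τ} {false} {i} {new α} i≤
              (box-first {j} {τ} {s} {ν 0 first ⇒ ν i (new α)} j≤ h (true⇒ν {j} {τ} {false} {0} {first} z≤n refl))))) ∷
      guarded-sound (suc j) (down second (ν i (new α)) ⇒ ν i (new α)) j+1≤ (λ τ s h →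
        true⇒ν {suc j} {τ} {s} {i} {new α} i≤ (subst (λ σ → Fact (at σ) i α) (twice τ)
          (ν⇒true {j} {τ + 2 ^ j} {true} {i} {new α} i≤
            (box-second {j} {τ} {s} {ν 0 second ⇒ ν i (new α)} j≤ h (true⇒ν {j} {τ + 2 ^ j} {true} {0} {second} z≤n refl))))) ∷ []
      where
      down : Kind → Formula → Formula
      down s B = □ (ν j level ⇒ ν 0 guard ⇒ ν 0 s ⇒ B)
      i≤ : i ≤ range
      i≤ = ≤-trans i≤m m≤range
      j+1≤ : suc j ≤ range
      j+1≤ = ≤-trans j<m m≤range
      j≤ : j ≤ range
      j≤ = <⇒≤ j+1≤
      true≢false : true ≢ false
      true≢false ()
      twice : ∀ τ → τ + 2 ^ j + 2 ^ j ≡ τ + 2 ^ suc j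
      twice τ = trans (+-assoc τ (2 ^ j) (2 ^ j)) (cong (λ a → τ + (2 ^ j + a)) (sym (+-identityʳ (2 ^ j))))

    module _ {j i : ℕ} (j≤m : j ≤ m) (i≤m : i ≤ m) where

      e : Counter → ℕ
      e = env j i

      e≤m : ∀ c → e c ≤ m
      e≤m outer = j≤m
      e≤m inner = i≤m
      e≤m none  = z≤n

      place≤ : ∀ {o} c → o ≤ 2 → o + e c ≤ range
      place≤ {o} c o≤2 = begin
        o + e c     ≤⟨ +-mono-≤ o≤2 (≤-trans (e≤m c) (m≤n+m m n)) ⟩
        2 + (n + m) ≡⟨ +-comm 2 (n + m) ⟩
        range       ∎
        where open ≤-Reasoning

      effect-sound : ∀ τ s t → let b , v = lookup (proj₂ (moves (proj₁ (at τ)) (heads (at τ)))) t in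
        ∀ {r} → r ∈ rules v → All (λ U → node base τ s ⊩ inst e U) (effect t b r)
      effect-sound τ s t {nothing , (d , c , o)} r∈ = true⇒ν {0} {τ} {s} {o + e c} {new (inj₂ (d , t , b))}
          (place≤ c (proj₁ (All.lookup (rules-offset v) r∈)))
          (subst (λ x → Fact x (o + e c) (inj₂ (d , t , b))) (sym (at-suc τ))
            (trans (cell-advance (at τ) t d (o + e c)) (cong (maybe′ _ b) (sym (All.lookup (rules-sound v j i) r∈))))) ∷ []
        where
        b = proj₁ (lookup (proj₂ (moves (proj₁ (at τ)) (heads (at τ)))) t)
        v = proj₂ (lookup (proj₂ (moves (proj₁ (at τ)) (heads (at τ)))) t)
      effect-sound τ s t {just (d′ , c′ , o′) , (d , c , o)} r∈ = All.map⁺ (All.universal (λ a h →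
          true⇒ν {0} {τ} {s} {o + e c} {new (inj₂ (d , t , a))} (place≤ c (proj₁ offsets))
            (subst (λ x → Fact x (o + e c) (inj₂ (d , t , a))) (sym (at-suc τ))
              (trans (trans (cell-advance (at τ) t d (o + e c)) (cong (maybe′ _ b) (sym (All.lookup (rules-sound v j i) r∈))))
                (ν⇒true {0} {τ} {s} {o′ + e c′} {old (inj₂ (d′ , t , a))} (place≤ c′ (proj₂ offsets)) h)))) (enum Γ-fin))
        where
        b = proj₁ (lookup (proj₂ (moves (proj₁ (at τ)) (heads (at τ)))) t)
        v = proj₂ (lookup (proj₂ (moves (proj₁ (at τ)) (heads (at τ)))) t)
        offsets = All.lookup (rules-offset v) r∈

      effects-sound : ∀ τ s → All (λ U → node base τ s ⊩ inst e U) (effects (moves (proj₁ (at τ)) (heads (at τ))))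
      effects-sound τ s =
        true⇒ν {0} {τ} {s} {i} {new (inj₁ (proj₁ (moves (proj₁ (at τ)) (heads (at τ)))))} (≤-trans i≤m m≤range)
          (cong proj₁ (at-suc τ)) ∷
        all-concatMap (allFin (suc k)) (λ t → All.concat⁺ (All.map⁺ (All.tabulate (effect-sound τ s t))))

      reading-heads-sound : ∀ τ s g U ts →
        ((∀ {t} → t ∈ ts → lookup (heads (at τ)) t ≡ lookup g t) → node base τ s ⊩ inst e U) →
        node base τ s ⊩ inst e (reading-heads g U ts)
      reading-heads-sound τ s g U []       h = h λ ()
      reading-heads-sound τ s g U (t ∷ ts) h ht = reading-heads-sound τ s g U ts λ hts → h λ
        { (here refl) → trans (Vec.lookup-map t scanned (proj₂ (at τ))) (trans (scanned≡cell (lookup (proj₂ (at τ)) t))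
                          (ν⇒true {0} {τ} {s} {0} {old (inj₂ (ahead , t , lookup g t))} z≤n ht))
        ; (there t∈)  → hts t∈ }

      -- The clause is stated for arbitrary q and g, but its premises force them to be the actual
      -- state and the actually scanned symbols, so its conclusion describes the actual step.
      transition-sound : ∀ q g → All (λ U → ∀ u → u ⊩ inst e U) (transition q g)
      transition-sound q g = All.map⁺ (All.tabulate λ {U} U∈ → guarded-sound 0 (inst e (reading q g U)) z≤n λ τ s hq →
        reading-heads-sound τ s g U (allFin (suc k)) λ hts → All.lookup
          (subst₂ (λ q g → All (λ U → node base τ s ⊩ inst e U) (effects (moves q g)))
            (ν⇒true {0} {τ} {s} {0} {old (inj₁ q)} z≤n hq)
            (lookup-ext _ _ λ t → hts (∈-allFin t)) (effects-sound τ s))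
          U∈)

    box-all : ∀ {B} → (∀ u → u ⊩ B) → ∀ u → u ⊩ (□ B)
    box-all h u = All.tabulate λ {v} _ → h v

    boxes-sound : ∀ {f} Us u → All (λ U → ∀ u → u ⊩ inst f U) Us → All (u ⊩_) (insts f (map □ᵀ_ Us))
    boxes-sound {f} Us u hs = All.map⁺ (All.map⁺ (All.map (λ {U} h → box-all {inst f U} h u) hs))

    inside-sound : ∀ {j i} → j < m → i ≤ m → All (λ U → ∀ u → u ⊩ inst (env j i) U) inside
    inside-sound j<m i≤m = All.++⁺
      (all-concatMap (enum finite-Attr) (λ α → halving-sound α j<m i≤m))
      (all-concatMap (enum Q-fin) (λ q → all-concatMap (enum (finite-Vec Γ-fin (suc k))) (transition-sound (<⇒≤ j<m) i≤m q)))

    edge-sound : All (λ U → ∀ u → u ⊩ inst (env m 0) U) edge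
    edge-sound = all-concatMap (allFin (suc k)) λ t → bound-sound ahead t ∷ bound-sound behind t ∷ []
      where
      bound-sound : ∀ d t u → u ⊩ inst (env m 0) (guarded none 0 (var outer 0 (new (inj₂ (d , t , blank)))))
      bound-sound d t = guarded-sound 0 (ν m (new (inj₂ (d , t , blank)))) z≤n λ τ s →
        true⇒ν {0} {τ} {s} {m} {new (inj₂ (d , t , blank))} m≤range (edge-blank (τ + 1) t d)

    clauses-sound : ∀ u → All (u ⊩_) (clauses m)
    clauses-sound u = All.++⁺
      (all-gather 0 m λ j j<m → all-gather 0 (suc m) λ i i≤m → boxes-sound inside u (inside-sound j<m (≤-pred i≤m)))
      (boxes-sound edge u edge-sound)

    module _ (rejected : accept (proj₁ final) ≡ false) where

      root : Node
      root = node (m + base) 0 false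

      hypotheses-hold : All (root ⊩_) (hypotheses m w)
      hypotheses-hold = All.++⁺ opening-holds (All.++⁺
        (all-gather 0 (suc m) λ i i≤m → sides-hold i (≤-trans (≤-pred i≤m) m≤range)) (All.++⁺
        (symbols-All w 0 λ j j<n → old-holds (inj₂ (ahead , zero , nth (map letter w) j))
          (≤-trans (subst (_≤ n) (sym (+-identityʳ j)) (<⇒≤ j<n)) (≤-trans (m≤m+n n m) (m≤m+n (n + m) 2)))
          (trans (cong (cell (lookup (proj₂ c₀) zero) ahead) (+-identityʳ j)) (initial-ahead j)))
        (blanks-hold n (suc m) ≤-refl ≤-refl)))
        where
        old-holds : ∀ {j} α → j ≤ range → Fact c₀ j α → root ⊩ ν j (old α)
        old-holds {j} α j≤ fact = true⇒ν {m} {0} {false} {j} {old α} j≤ fact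
        rejecting-holds : ∀ q → All (λ U → root ⊩ inst (env m 0) U) (rejecting q)
        rejecting-holds q with accept q in acc
        ... | false = []
        ... | true  = (λ h → contra (trans (sym (cong proj₁ at-2^m)) (ν⇒true {m} {0} {false} {0} {new (inj₁ q)} z≤n h))) ∷ []
          where
          contra : proj₁ final ≡ q → ⊥
          contra refl with () ← trans (sym acc) rejected
        opening-holds : All (root ⊩_) (insts (env m 0) opening)
        opening-holds = true⇒ν {m} {0} {false} {m} {level} m≤range refl ∷ true⇒ν {m} {0} {false} {0} {guard} z≤n tt ∷
          All.map⁺ (all-concatMap (enum Q-fin) rejecting-holds)
        sides-hold : ∀ i → i ≤ range → All (root ⊩_) (insts (env m i) sides)
        sides-hold i i≤ = old-holds (inj₁ start) i≤ refl ∷ All.map⁺ (All.++⁺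
          (All.map⁺ (All.universal (λ t → old-holds (inj₂ (behind , t , blank)) i≤ (initial-behind t i)) (allFin (suc k))))
          (All.map⁺ (All.universal (λ t → old-holds (inj₂ (ahead , suc t , blank)) i≤ (initial-other t i)) (allFin k))))
        blanks-hold : ∀ i l → n ≤ i → i + l ≤ n + suc m → All (root ⊩_) (gather i l (λ i → insts (env m i) blanks))
        blanks-hold i zero    n≤i i≤ = []
        blanks-hold i (suc l) n≤i i≤ =
          old-holds (inj₂ (ahead , zero , blank)) (≤-trans i≤n+m (m≤m+n (n + m) 2))
            (trans (initial-ahead i) (nth-≥ (map letter w) (subst (_≤ i) (sym (List.length-map letter w)) n≤i))) ∷
          blanks-hold (suc i) l (m≤n⇒m≤1+n n≤i) (subst (_≤ n + suc m) (+-suc i l) i≤)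
          where
          i≤n+m : i ≤ n + m
          i≤n+m = ≤-pred (≤-trans (s≤s (m≤m+n i l)) (subst₂ _≤_ (+-suc i l) (+-suc n m) i≤))

      unprovable : ¬ (IL⊢ formula w)
      unprovable p = ⊩-foldr (hypotheses m w) (All.lookup goal (here refl)) hypotheses-hold
        where
        -- One rank above the root, whose hypotheses stand under a box; the root is the first
        -- successor of this node.
        top : Node
        top = node (suc m + base) 0 false
        goal : top ⊩ (□ (foldr _⇒_ ⊥ᶠ (hypotheses m w)))
        goal = ⊩-foldr (clauses m) (sound p top) (clauses-sound top)

    closed-inst : ∀ f U → Closed (inst f U)
    closed-inst f (var c o κ) = ((closed-high i , closed-high (suc i)) , tt)
      where
      i = code κ + (o + f c) * K#
      closed-□^⊥ : ∀ i → Closed (□^⊥ i)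
      closed-□^⊥ zero    = tt
      closed-□^⊥ (suc i) = closed-□^⊥ i
      closed-high : ∀ i → Closed (high i)
      closed-high i = closed-□^⊥ i , tt
    closed-inst f ⊥ᵀ       = tt
    closed-inst f (U ⇒ᵀ V) = closed-inst f U , closed-inst f V
    closed-inst f (□ᵀ U)   = closed-inst f U

    closed-insts : ∀ f Us → All Closed (insts f Us)
    closed-insts f Us = All.map⁺ (All.universal (closed-inst f) Us)

    closed-foldr : ∀ {B As} → All Closed As → Closed B → Closed (foldr _⇒_ B As)
    closed-foldr []       b = b
    closed-foldr (a ∷ as) b = a , closed-foldr as b

    closed : Closed (formula w)
    closed = closed-foldr
      (All.++⁺ (all-gather 0 m λ j _ → all-gather 0 (suc m) λ i _ → closed-insts (env j i) (map □ᵀ_ inside))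
               (closed-insts (env m 0) (map □ᵀ_ edge)))
      (closed-foldr
        (All.++⁺ (closed-insts (env m 0) opening)
          (All.++⁺ (all-gather 0 (suc m) λ i _ → closed-insts (env m i) sides)
            (All.++⁺ (symbols-All w 0 λ j _ → closed-inst (env 0 (j + 0)) (var inner 0 (old (inj₂ (ahead , zero , nth (map letter w) j)))))
              (all-gather n (suc m) λ i _ → closed-insts (env m i) blanks))))
        tt)

    reduces : L w ⇔ IL₀ (encode (formula w))
    reduces = mk⇔
      (λ l → formula w , refl , closed , provable (Equivalence.to (proj₂ (proj₂ run)) l))
      (λ (φ , eq , closed-φ , ⊢φ) → Equivalence.from (proj₂ (proj₂ run)) (accepted (subst IL⊢_ (unique φ closed-φ eq) ⊢φ)))
      where
      -- Membership in `IL₀` provides only some closed theorem with this code.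
      unique : ∀ φ → Closed φ → encode φ ≡ encode (formula w) → φ ≡ formula w
      unique φ closed-φ eq = proj₁ (encode-injective φ (formula w) closed-φ closed (cong (_++ []) eq))
      accepted : IL⊢ formula w → accept (proj₁ final) ≡ true
      accepted p with accept (proj₁ final) in acc
      ... | true  = refl
      ... | false = ⊥-elim (unprovable acc p)

  reduction : L ≤ₚ IL₀
  reduction = encode ∘ formula , formula-polyTime , Instance.reduces

mainTheorem3 : PSPACE-hard IL₀
mainTheorem3 A-fin L P = Reduction.reduction A-fin P
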